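{- Let $M$ be a non-deterministic $\lambda$-term. (1) If $M$ is strongly normalizable, then $\mathcal T(M)\in(\uparrow\mathfrak T)^\perp$ for every structure $\mathfrak T\subseteq\mathfrak B$. (2) If $\mathfrak T$ is a structure with $\mathfrak L\subseteq\mathfrak T$ and $\mathcal T(M)\in(\uparrow\mathfrak T)^\perp$, then $M$ is strongly normalizable.
   Context: Non-deterministic $\lambda$-terms are given by $M::=x\mid\lambda x.M\mid (M)N\mid M+N$, taken up to $\alpha$-equivalence and the identities $M+N=N+M$, $(M+N)+P=M+(N+P)$, $\lambda x.(M+N)=\lambda x.M+\lambda x.N$, $(M+N)P=(M)P+(N)P$. Application is not linear in its argument, and $+$ is not idempotent. $\beta$-reduction $\to_\beta$ is the contextual closure of $(\lambda x.M)N\to_\beta M[N/x]$. The term $M$ is strongly normalizable if there is no infinite $\beta$-reduction sequence starting from $M$. Resource terms are given by $s::=x\mid\lambda x.s\mid\langle s\rangle\bar t$, where a bag $\bar t=[t_1,\dots,t_n]$ ($n\ge0$) is a finite multiset of resource terms; they are taken up to $\alpha$-equivalence. $\Delta$ denotes the set of resource terms. For $a\subseteq\Delta$, $a^!$ is the set of all bags all of whose elements lie in $a$. The support of the Taylor expansion $\mathcal T(M)\subseteq\Delta$ is defined by: - $\mathcal T(x)=\{x\}$; - $\mathcal T(\lambda x.M)=\{\lambda x.s: s\in\mathcal T(M)\}$; - $\mathcal T((M)N)=\{\langle s\rangle\bar t: s\in\mathcal T(M),\ \bar t\in\mathcal T(N)^!\}$; - $\mathcal T(M+N)=\mathcal T(M)\cup\mathcal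 T(N)$. Resource reduction. For $t\in\Delta$ and a bag $[s_1,\dots,s_n]$, the differential substitution $t\langle[s_1,\dots,s_n]/x\rangle$ is a finite formal sum with natural number coefficients. If $x$ has exactly $n$ free occurrences $x_1,\dots,x_n$ in $t$, it is $\sum_{f\in S_n} t[s_{f(1)}/x_1,\dots,s_{f(n)}/x_n]$, where occurrence $x_i$ is replaced by $s_{f(i)}$; otherwise it is $0$. Resource reduction $\to_r$ acts on finite formal sums of resource terms (constructors extended linearly). It is the smallest relation containing $\langle\lambda x.t\rangle[s_1,\dots,s_n]\to_r t\langle[s_1,\dots,s_n]/x\rangle$ and such that whenever $t\to_r a$ we have: - $\lambda x.t\to_r\lambda x.a$; - $\langle t\rangle\bar s\to_r\langle a\rangle\bar s$; - $\langle u\rangle([t]+\bar s)\to_r\langle u\rangle([a]+\bar s)$; - $\alpha t+b\to_r\alpha a+b$ for nonzero scalars $\alpha$. For $s,t\in\Delta$ write $t\ge s$ if $t\to_r^* a$ for some sum $a$ whose support contains $s$. For $a\subseteq\Delta$, the cone is $\uparrow a=\{t\in\Delta:\exists s\in a,\ t\ge s\}$. A structure is any $\mathfrak T\subseteq\mathcal P(\Delta)$. Set $\uparrow\mathfrak T=\{\uparrow a: a\in\mathfrak T\}$. For a structure $\mathfrak S$, $\mathfrak S^\perp=\{a\subseteq\Delta:\forall a'\in\mathfrak S,\ a\cap a'\text{ is finite}\}$. A resource term is linear if every bag occurring in it has cardinality exactly $1$. $\mathfrak L$ is the set of all sets of linear resource terms. $\mathfrak B$ is the set of all $a\subseteq\Delta$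 for which some $n\in\mathbb N$ bounds the cardinality of every bag occurring in every term of $a$. -}

module Defs where

open import Data.Nat using (ℕ; zero; suc; _+_; _≤_; pred; _≡ᵇ_; _<ᵇ_)
open import Data.Bool using (Bool; true; false; if_then_else_)
open import Data.List using (List; []; _∷_; [_]; _++_; map; concatMap; length; replicate; concat)
open import Data.List.Relation.Unary.All using (All)
open import Data.List.Relation.Unary.Any using (Any)
open import Data.List.Relation.Binary.Permutation.Propositional using (_↭_)
open import Data.Product using (Σ; _×_; _,_; ∃; proj₁; proj₂)
open import Relation.Binary.PropositionalEquality using (_≡_)
open import Relation.Binary.Construct.Closure.ReflexiveTransitive using (Star)
open import Induction.WellFounded using (Acc)
open import Level using () renaming (suc to lsuc; zero to lzero)

-- Non-deterministic λ-terms (de Bruijn indices, so α-equivalence is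
-- built in).  The identities (comm./assoc. of +, λ and left-application
-- distributing over +) are imposed by the congruence _≈_ below.

infixl 6 _⊕_
data Term : Set where
  var : ℕ → Term
  lam : Term → Term
  app : Term → Term → Term
  _⊕_ : Term → Term → Term

ext : (ℕ → ℕ) → ℕ → ℕ
ext ρ zero    = zero
ext ρ (suc k) = suc (ρ k)

rename : (ℕ → ℕ) → Term → Term
rename ρ (var k)   = var (ρ k)
rename ρ (lam M)   = lam (rename (ext ρ) M)
rename ρ (app M N) = app (rename ρ M) (rename ρ N)
rename ρ (M ⊕ N)   = rename ρ M ⊕ rename ρ N

exts : (ℕ → Term) → ℕ → Term
exts σ zero    = var zero
exts σ (suc k) = rename suc (σ k)

subst : (ℕ → Term) → Term → Term
subst σ (var k)   = σ k
subst σ (lam M)   = lam (subst (exts σ) M)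
subst σ (app M N) = app (subst σ M) (subst σ N)
subst σ (M ⊕ N)   = subst σ M ⊕ subst σ N

σ₀ : Term → ℕ → Term
σ₀ N zero    = N
σ₀ N (suc k) = var k

_[_/0] : Term → Term → Term
M [ N /0] = subst (σ₀ N) M

infix 4 _≈_
data _≈_ : Term → Term → Set where
  ≈-refl  : ∀ {M} → M ≈ M
  ≈-sym   : ∀ {M N} → M ≈ N → N ≈ M
  ≈-trans : ∀ {M N P} → M ≈ N → N ≈ P → M ≈ P
  ≈-lam   : ∀ {M M'} → M ≈ M' → lam M ≈ lam M'
  ≈-app   : ∀ {M M' N N'} → M ≈ M' → N ≈ N' → app M N ≈ app M' N'
  ≈-⊕     : ∀ {M M' N N'} → M ≈ M' → N ≈ N' → M ⊕ N ≈ M' ⊕ N'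
  ⊕-comm  : ∀ {M N} → M ⊕ N ≈ N ⊕ M
  ⊕-assoc : ∀ {M N P} → (M ⊕ N) ⊕ P ≈ M ⊕ (N ⊕ P)
  lam-⊕   : ∀ {M N} → lam (M ⊕ N) ≈ lam M ⊕ lam N
  app-⊕   : ∀ {M N P} → app (M ⊕ N) P ≈ app M P ⊕ app N P

infix 4 _→β_
data _→β_ : Term → Term → Set where
  β     : ∀ {M N} → app (lam M) N →β M [ N /0]
  ξ-lam : ∀ {M M'} → M →β M' → lam M →β lam M'
  ξ-appˡ : ∀ {M M' N} → M →β M' → app M N →β app M' N
  ξ-appʳ : ∀ {M N N'} → N →β N' → app M N →β app M N'
  ξ-⊕ˡ  : ∀ {M M' N} → M →β M' → M ⊕ N →β M' ⊕ N
  ξ-⊕ʳ  : ∀ {M N N'} → N →β N' → M ⊕ N →β M ⊕ N'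

infix 4 _⇒β_
_⇒β_ : Term → Term → Set
M ⇒β N = Σ Term λ M' → Σ Term λ N' → (M ≈ M') × (M' →β N') × (N' ≈ N)

SN : Term → Set
SN M = Acc (λ N M → M ⇒β N) M

-- Resource terms; a bag is a list taken up to permutation (see _≋_)

data RTerm : Set where
  rvar : ℕ → RTerm
  rlam : RTerm → RTerm
  rapp : RTerm → List RTerm → RTerm

Bag : Set
Bag = List RTerm

infix 4 _≋_ _≋ᵇ_
data _≋_ : RTerm → RTerm → Set
data _≋ᵇ_ : Bag → Bag → Set

data _≋_ where
  ≋-var : ∀ {k} → rvar k ≋ rvar k
  ≋-lam : ∀ {s s'} → s ≋ s' → rlam s ≋ rlam s'
  ≋-app : ∀ {s s' b b'} → s ≋ s' → b ≋ᵇ b' → rapp s b ≋ rapp s' b'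

data _≋ᵇ_ where
  []    : [] ≋ᵇ []
  _∷_   : ∀ {t t' b b'} → t ≋ t' → b ≋ᵇ b' → (t ∷ b) ≋ᵇ (t' ∷ b')
  swap  : ∀ {t u b} → (t ∷ u ∷ b) ≋ᵇ (u ∷ t ∷ b)
  trans : ∀ {b b' b''} → b ≋ᵇ b' → b' ≋ᵇ b'' → b ≋ᵇ b''

rrename  : (ℕ → ℕ) → RTerm → RTerm
rrenameᵇ : (ℕ → ℕ) → Bag → Bag
rrename ρ (rvar k)   = rvar (ρ k)
rrename ρ (rlam s)   = rlam (rrename (ext ρ) s)
rrename ρ (rapp s b) = rapp (rrename ρ s) (rrenameᵇ ρ b)
rrenameᵇ ρ []      = []
rrenameᵇ ρ (t ∷ b) = rrename ρ t ∷ rrenameᵇ ρ b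

occ  : ℕ → RTerm → ℕ
occᵇ : ℕ → Bag → ℕ
occ d (rvar k)   = if k ≡ᵇ d then 1 else 0
occ d (rlam s)   = occ (suc d) s
occ d (rapp s b) = occ d s + occᵇ d b
occᵇ d []      = 0
occᵇ d (t ∷ b) = occ d t + occᵇ d b

-- linear substitution: the successive (left-to-right) free occurrences
-- x₁,x₂,… of the variable (index d) are replaced by the successive
-- elements of the list; the variable's binder is removed (indices > d
-- are decremented).  Returns the unused part of the list.
linVar : ℕ → ℕ → List RTerm → RTerm × List RTerm
linVar d k []       = (if k ≡ᵇ d then rvar k else (if d <ᵇ k then rvar (pred k) else rvar k)) , []
linVar d k (u ∷ us) =
  if k ≡ᵇ d then (rrename (d +_) u , us)
  else ((if d <ᵇ k then rvar (pred k) else rvar k) , u ∷ us)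

lin  : ℕ → RTerm → List RTerm → RTerm × List RTerm
linᵇ : ℕ → Bag → List RTerm → Bag × List RTerm
lin d (rvar k)   us = linVar d k us
lin d (rlam s)   us = rlam (proj₁ (lin (suc d) s us)) , proj₂ (lin (suc d) s us)
lin d (rapp s b) us =
  rapp (proj₁ (lin d s us)) (proj₁ (linᵇ d b (proj₂ (lin d s us))))
  , proj₂ (linᵇ d b (proj₂ (lin d s us)))
linᵇ d []      us = [] , us
linᵇ d (t ∷ b) us =
  (proj₁ (lin d t us) ∷ proj₁ (linᵇ d b (proj₂ (lin d t us))))
  , proj₂ (linᵇ d b (proj₂ (lin d t us)))

insertions : {A : Set} → A → List A → List (List A)
insertions x []       = [ x ∷ [] ]
insertions x (y ∷ ys) = (x ∷ y ∷ ys) ∷ map (y ∷_) (insertions x ys)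

perms : {A : Set} → List A → List (List A)
perms []       = [ [] ]
perms (x ∷ xs) = concatMap (insertions x) (perms xs)

-- Finite formal sums with ℕ coefficients: a list, each element counted
-- with its multiplicity (order irrelevant).
RSum : Set
RSum = List RTerm

dsubst : RTerm → Bag → RSum
dsubst t b =
  if occ 0 t ≡ᵇ length b then map (λ us → proj₁ (lin 0 t us)) (perms b) else []

infix 4 _↦_
data _↦_ : RTerm → RSum → Set where
  r-β   : ∀ {t b} → rapp (rlam t) b ↦ dsubst t b
  r-lam : ∀ {t a} → t ↦ a → rlam t ↦ map rlam a
  r-appˡ : ∀ {t a b} → t ↦ a → rapp t b ↦ map (λ t' → rapp t' b) a
  r-appʳ : ∀ {u t a b₁ b₂} → t ↦ a →
           rapp u (b₁ ++ t ∷ b₂) ↦ map (λ t' → rapp u (b₁ ++ t' ∷ b₂)) a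

infix 4 _⟶_
data _⟶_ : RSum → RSum → Set where
  step : ∀ {s s' k t a b} → s ↭ (replicate (suc k) t ++ b) → t ↦ a →
         s' ↭ (concat (replicate (suc k) a) ++ b) → s ⟶ s'

_∈supp_ : RTerm → RSum → Set
s ∈supp a = Any (s ≋_) a

infix 4 _≥r_
_≥r_ : RTerm → RTerm → Set
t ≥r s = Σ RSum λ a → Star _⟶_ [ t ] a × (s ∈supp a)

PΔ : Set₁
PΔ = RTerm → Set

Closed : PΔ → Set
Closed a = ∀ {s t} → s ≋ t → a s → a t

Structure : Set₂
Structure = PΔ → Set₁

-- support of the Taylor expansion
data 𝒯 : Term → PΔ where
  t-var : ∀ {k} → 𝒯 (var k) (rvar k)
  t-lam : ∀ {M s} → 𝒯 M s → 𝒯 (lam M) (rlam s)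
  t-app : ∀ {M N s b} → 𝒯 M s → All (𝒯 N) b → 𝒯 (app M N) (rapp s b)
  t-⊕ˡ  : ∀ {M N s} → 𝒯 M s → 𝒯 (M ⊕ N) s
  t-⊕ʳ  : ∀ {M N s} → 𝒯 N s → 𝒯 (M ⊕ N) s

↑ : PΔ → PΔ
↑ a t = Σ RTerm λ s → a s × (t ≥r s)

↑ˢ : Structure → Structure
↑ˢ 𝔗 b = Σ PΔ λ a → 𝔗 a × (b ≡ ↑ a)

Finite : PΔ → Set
Finite a = Σ (List RTerm) λ L → ∀ t → a t → Any (t ≋_) L

_⊥ : Structure → PΔ → Set₁
(𝔖 ⊥) a = ∀ a' → 𝔖 a' → Finite (λ t → a t × a' t)

data Linear : RTerm → Set where
  l-var : ∀ {k} → Linear (rvar k)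
  l-lam : ∀ {s} → Linear s → Linear (rlam s)
  l-app : ∀ {s u} → Linear s → Linear u → Linear (rapp s (u ∷ []))

𝔏 : Structure
𝔏 a = Lift (lsuc lzero) (Closed a × (∀ t → a t → Linear t))
  where open import Level using (Lift)

data BagsBounded (n : ℕ) : RTerm → Set where
  bb-var : ∀ {k} → BagsBounded n (rvar k)
  bb-lam : ∀ {s} → BagsBounded n s → BagsBounded n (rlam s)
  bb-app : ∀ {s b} → BagsBounded n s → length b ≤ n → All (BagsBounded n) b →
           BagsBounded n (rapp s b)

𝔅 : Structure
𝔅 a = Lift (lsuc lzero) (Σ ℕ λ n → ∀ t → a t → BagsBounded n t)
  where open import Level using (Lift)

_⊆ˢ_ : Structure → Structure → Set₁
𝔖 ⊆ˢ 𝔗 = ∀ a → 𝔖 a → 𝔗 a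

{-# OPTIONS --safe #-}
module Submission where

-- Strong normalisation is first replaced by the inductive predicate SNI, which follows the
-- perpetual (head) strategy and, at a head redex, also asks for the erasable components.
-- By induction on SNI the expansions of M which reduce to a term with bags of size at most n
-- have bounded size: if the head redex of such an expansion is ever fired then it can be
-- fired first, and firing it at most halves the size, up to a constant; if it is never fired
-- then the bags around it already have size at most n.  Conversely, if the expansions of M
-- that reduce to a linear term have size at most m, then SNI holds by induction on m: a head
-- reduction strictly lowers the bound, because its inverse can be lifted to expansions, and
-- the components of M can be completed to expansions of M by linear terms.

open import Defs
open import Data.Product using (_×_)
open import Algebra.Properties.CommutativeSemigroup using () renaming (interchange to ∙-interchange)
open import Data.Bool using (true; false; T; if_then_else_)
open import Data.List using (List; []; _∷_; [_]; _++_; map; concatMap; length; replicate; concat)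
open import Data.List.Membership.Propositional using (_∈_; find; lose)
open import Data.List.Membership.Propositional.Properties using (∈-map⁺; ∈-map⁻; ∈-++⁻; ∈-++⁺ˡ; ∈-++⁺ʳ; ∈-∃++; ∈-concatMap⁺; ∈-concatMap⁻; ∈-concat⁻′)
open import Data.List.Properties using (++-assoc; ++-identityʳ; length-++; map-++; map-∘; map-id; concatMap-cong; concatMap-map; map-concatMap; concatMap-++)
open import Data.List.Relation.Binary.Permutation.Homogeneous as Perm using ()
open import Data.List.Relation.Binary.Permutation.Propositional using (_↭_; refl; prep; swap; trans; ↭-sym; ↭-trans; ↭-reflexive)
open import Data.List.Relation.Binary.Permutation.Propositional.Properties using (All-resp-↭; ∈-resp-↭; ↭-empty-inv; ↭-singleton-inv; ↭-length; ++⁺; ++⁺ˡ; ++⁺ʳ; shift; shifts; drop-mid)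
open import Data.List.Relation.Binary.Pointwise using (Pointwise; []; _∷_)
open import Data.List.Relation.Unary.All as All using (All; []; _∷_)
import Data.List.Relation.Unary.All.Properties as All
open import Data.List.Relation.Unary.Any using (Any; here; there)
open import Data.Nat using (ℕ; zero; suc; pred; _+_; _*_; _≤_; _<_; z≤n; s≤s; _≡ᵇ_; _<ᵇ_)
open import Data.Nat.Induction using (<-wellFounded)
open import Data.Nat.Properties
open import Data.Product using (∃; _,_; proj₁; proj₂)
open import Data.Sum using (_⊎_; inj₁; inj₂)
open import Data.Unit using (tt)
open import Function using (_∘_; id)
open import Induction.WellFounded using (Acc; acc)
open import Level using (lift; lower)
open import Relation.Binary.Bundles using (Setoid)
open import Relation.Binary.Construct.Closure.ReflexiveTransitive using (Star; ε; _◅_; _◅◅_; gmap)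
open import Relation.Binary.Definitions using (tri<; tri≈; tri>)
open import Relation.Binary.PropositionalEquality as ≡ using (_≡_; _≗_; refl; cong; cong₂)
open import Relation.Nullary using (¬_; contradiction)

-- Renaming and substitution in λ-terms

-- `𝒯 M` is infinite as soon as `M` contains an application, since bags may have any length. Its
-- trace on a cone can be finite because a nonzero resource reduction neither copies nor discards: a
-- consumed bag survives, element by element, in the contractum, and a bag that is never consumed
-- keeps its length, which the target of the reduction limits. Conversely, a linear target may keep
-- redexes unfired, so that even an argument which β-reduction would erase is measured. The other
-- obstacle is `≈`. It lets `app (lam (M ⊕ N)) P` be read as two redexes, one of which can be
-- contracted alone, so `SN` does not follow the syntax of a term. `SNI` does; the way back from
-- `SNI` to `SN` goes through lists of summands, where `≈` amounts to permutation and to `≈` inside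
-- arguments.

ext-cong : ∀ {ρ ρ'} → ρ ≗ ρ' → ext ρ ≗ ext ρ'
ext-cong e zero    = refl
ext-cong e (suc k) = cong suc (e k)

ext-∘ : ∀ ρ ρ' → ext ρ ∘ ext ρ' ≗ ext (ρ ∘ ρ')
ext-∘ ρ ρ' zero    = refl
ext-∘ ρ ρ' (suc k) = refl

rename-cong : ∀ {ρ ρ'} → ρ ≗ ρ' → rename ρ ≗ rename ρ'
rename-cong e (var k)   = cong var (e k)
rename-cong e (lam M)   = cong lam (rename-cong (ext-cong e) M)
rename-cong e (app M N) = cong₂ app (rename-cong e M) (rename-cong e N)
rename-cong e (M ⊕ N)   = cong₂ _⊕_ (rename-cong e M) (rename-cong e N)

rename-∘ : ∀ ρ ρ' M → rename ρ (rename ρ' M) ≡ rename (ρ ∘ ρ') M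
rename-∘ ρ ρ' (var k)   = refl
rename-∘ ρ ρ' (lam M)   = cong lam (≡.trans (rename-∘ (ext ρ) (ext ρ') M) (rename-cong (ext-∘ ρ ρ') M))
rename-∘ ρ ρ' (app M N) = cong₂ app (rename-∘ ρ ρ' M) (rename-∘ ρ ρ' N)
rename-∘ ρ ρ' (M ⊕ N)   = cong₂ _⊕_ (rename-∘ ρ ρ' M) (rename-∘ ρ ρ' N)

exts-cong : ∀ {σ τ} → σ ≗ τ → exts σ ≗ exts τ
exts-cong e zero    = refl
exts-cong e (suc k) = cong (rename suc) (e k)

subst-cong : ∀ {σ τ} → σ ≗ τ → subst σ ≗ subst τ
subst-cong e (var k)   = e k
subst-cong e (lam M)   = cong lam (subst-cong (exts-cong e) M)
subst-cong e (app M N) = cong₂ app (subst-cong e M) (subst-cong e N)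
subst-cong e (M ⊕ N)   = cong₂ _⊕_ (subst-cong e M) (subst-cong e N)

exts-var : exts var ≗ var
exts-var zero    = refl
exts-var (suc k) = refl

subst-var : ∀ M → subst var M ≡ M
subst-var (var k)   = refl
subst-var (lam M)   = cong lam (≡.trans (subst-cong exts-var M) (subst-var M))
subst-var (app M N) = cong₂ app (subst-var M) (subst-var N)
subst-var (M ⊕ N)   = cong₂ _⊕_ (subst-var M) (subst-var N)

exts-ext : ∀ σ ρ → exts σ ∘ ext ρ ≗ exts (σ ∘ ρ)
exts-ext σ ρ zero    = refl
exts-ext σ ρ (suc k) = refl

subst-rename : ∀ σ ρ M → subst σ (rename ρ M) ≡ subst (σ ∘ ρ) M
subst-rename σ ρ (var k)   = refl
subst-rename σ ρ (lam M)   = cong lam (≡.trans (subst-rename (exts σ) (ext ρ) M) (subst-cong (exts-ext σ ρ) M))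
subst-rename σ ρ (app M N) = cong₂ app (subst-rename σ ρ M) (subst-rename σ ρ N)
subst-rename σ ρ (M ⊕ N)   = cong₂ _⊕_ (subst-rename σ ρ M) (subst-rename σ ρ N)

rename-exts : ∀ ρ σ → rename (ext ρ) ∘ exts σ ≗ exts (rename ρ ∘ σ)
rename-exts ρ σ zero    = refl
rename-exts ρ σ (suc k) = ≡.trans (rename-∘ (ext ρ) suc (σ k)) (≡.sym (rename-∘ suc ρ (σ k)))

rename-subst : ∀ ρ σ M → rename ρ (subst σ M) ≡ subst (rename ρ ∘ σ) M
rename-subst ρ σ (var k)   = refl
rename-subst ρ σ (lam M)   = cong lam (≡.trans (rename-subst (ext ρ) (exts σ) M) (subst-cong (rename-exts ρ σ) M))
rename-subst ρ σ (app M N) = cong₂ app (rename-subst ρ σ M) (rename-subst ρ σ N)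
rename-subst ρ σ (M ⊕ N)   = cong₂ _⊕_ (rename-subst ρ σ M) (rename-subst ρ σ N)

subst-exts : ∀ τ σ → subst (exts τ) ∘ exts σ ≗ exts (subst τ ∘ σ)
subst-exts τ σ zero    = refl
subst-exts τ σ (suc k) = ≡.trans (subst-rename (exts τ) suc (σ k)) (≡.sym (rename-subst suc τ (σ k)))

subst-∘ : ∀ τ σ M → subst τ (subst σ M) ≡ subst (subst τ ∘ σ) M
subst-∘ τ σ (var k)   = refl
subst-∘ τ σ (lam M)   = cong lam (≡.trans (subst-∘ (exts τ) (exts σ) M) (subst-cong (subst-exts τ σ) M))
subst-∘ τ σ (app M N) = cong₂ app (subst-∘ τ σ M) (subst-∘ τ σ N)
subst-∘ τ σ (M ⊕ N)   = cong₂ _⊕_ (subst-∘ τ σ M) (subst-∘ τ σ N)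

subst-[/0] : ∀ τ M N → subst τ (M [ N /0]) ≡ subst (exts τ) M [ subst τ N /0]
subst-[/0] τ M N = ≡.trans (subst-∘ τ (σ₀ N) M)
  (≡.sym (≡.trans (subst-∘ (σ₀ (subst τ N)) (exts τ) M) (subst-cong pointwise M)))
  where
  pointwise : subst (σ₀ (subst τ N)) ∘ exts τ ≗ subst τ ∘ σ₀ N
  pointwise zero    = refl
  pointwise (suc k) = ≡.trans (subst-rename (σ₀ (subst τ N)) suc (τ k)) (subst-var (τ k))

rename-[/0] : ∀ ρ M N → rename ρ (M [ N /0]) ≡ rename (ext ρ) M [ rename ρ N /0]
rename-[/0] ρ M N = ≡.trans (rename-subst ρ (σ₀ N) M)
  (≡.sym (≡.trans (subst-rename (σ₀ (rename ρ N)) (ext ρ) M) (subst-cong pointwise M)))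
  where
  pointwise : σ₀ (rename ρ N) ∘ ext ρ ≗ rename ρ ∘ σ₀ N
  pointwise zero    = refl
  pointwise (suc k) = refl

rename-≈ : ∀ {ρ M M'} → M ≈ M' → rename ρ M ≈ rename ρ M'
rename-≈ ≈-refl        = ≈-refl
rename-≈ (≈-sym e)     = ≈-sym (rename-≈ e)
rename-≈ (≈-trans e f) = ≈-trans (rename-≈ e) (rename-≈ f)
rename-≈ (≈-lam e)     = ≈-lam (rename-≈ e)
rename-≈ (≈-app e f)   = ≈-app (rename-≈ e) (rename-≈ f)
rename-≈ (≈-⊕ e f)     = ≈-⊕ (rename-≈ e) (rename-≈ f)
rename-≈ ⊕-comm        = ⊕-comm
rename-≈ ⊕-assoc       = ⊕-assoc
rename-≈ lam-⊕         = lam-⊕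
rename-≈ app-⊕         = app-⊕

subst-≈ : ∀ {σ M M'} → M ≈ M' → subst σ M ≈ subst σ M'
subst-≈ ≈-refl        = ≈-refl
subst-≈ (≈-sym e)     = ≈-sym (subst-≈ e)
subst-≈ (≈-trans e f) = ≈-trans (subst-≈ e) (subst-≈ f)
subst-≈ (≈-lam e)     = ≈-lam (subst-≈ e)
subst-≈ (≈-app e f)   = ≈-app (subst-≈ e) (subst-≈ f)
subst-≈ (≈-⊕ e f)     = ≈-⊕ (subst-≈ e) (subst-≈ f)
subst-≈ ⊕-comm        = ⊕-comm
subst-≈ ⊕-assoc       = ⊕-assoc
subst-≈ lam-⊕         = lam-⊕
subst-≈ app-⊕         = app-⊕

subst-≈ᵖ : ∀ {σ τ} M → (∀ k → σ k ≈ τ k) → subst σ M ≈ subst τ M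
subst-≈ᵖ (var k)   e = e k
subst-≈ᵖ (lam M)   e = ≈-lam (subst-≈ᵖ M λ where
  zero    → ≈-refl
  (suc k) → rename-≈ (e k))
subst-≈ᵖ (app M N) e = ≈-app (subst-≈ᵖ M e) (subst-≈ᵖ N e)
subst-≈ᵖ (M ⊕ N)   e = ≈-⊕ (subst-≈ᵖ M e) (subst-≈ᵖ N e)

[/0]-≈ : ∀ {M M' N N'} → M ≈ M' → N ≈ N' → M [ N /0] ≈ M' [ N' /0]
[/0]-≈ {M' = M'} e f = ≈-trans (subst-≈ e) (subst-≈ᵖ M' λ where
  zero    → f
  (suc k) → ≈-refl)

rename-→β : ∀ {ρ M M'} → M →β M' → rename ρ M →β rename ρ M'
rename-→β {ρ} (β {M} {N}) =
  ≡.subst (app (lam (rename (ext ρ) M)) (rename ρ N) →β_) (≡.sym (rename-[/0] ρ M N)) β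
rename-→β (ξ-lam r)  = ξ-lam (rename-→β r)
rename-→β (ξ-appˡ r) = ξ-appˡ (rename-→β r)
rename-→β (ξ-appʳ r) = ξ-appʳ (rename-→β r)
rename-→β (ξ-⊕ˡ r)   = ξ-⊕ˡ (rename-→β r)
rename-→β (ξ-⊕ʳ r)   = ξ-⊕ʳ (rename-→β r)

subst-→β : ∀ {σ M M'} → M →β M' → subst σ M →β subst σ M'
subst-→β {σ} (β {M} {N}) =
  ≡.subst (app (lam (subst (exts σ) M)) (subst σ N) →β_) (≡.sym (subst-[/0] σ M N)) β
subst-→β (ξ-lam r)  = ξ-lam (subst-→β r)
subst-→β (ξ-appˡ r) = ξ-appˡ (subst-→β r)
subst-→β (ξ-appʳ r) = ξ-appʳ (subst-→β r)
subst-→β (ξ-⊕ˡ r)   = ξ-⊕ˡ (subst-→β r)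
subst-→β (ξ-⊕ʳ r)   = ξ-⊕ʳ (subst-→β r)

subst-→β* : ∀ {σ τ} M → (∀ k → Star _→β_ (σ k) (τ k)) → Star _→β_ (subst σ M) (subst τ M)
subst-→β* (var k)   r = r k
subst-→β* (lam M)   r = gmap lam ξ-lam (subst-→β* M λ where
  zero    → ε
  (suc k) → gmap (rename suc) rename-→β (r k))
subst-→β* (app M N) r =
  gmap (λ P → app P _) ξ-appˡ (subst-→β* M r) ◅◅ gmap (app _) ξ-appʳ (subst-→β* N r)
subst-→β* (M ⊕ N)   r =
  gmap (_⊕ _) ξ-⊕ˡ (subst-→β* M r) ◅◅ gmap (_ ⊕_) ξ-⊕ʳ (subst-→β* N r)

[/0]-→β* : ∀ M {N N'} → N →β N' → Star _→β_ (M [ N /0]) (M [ N' /0])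
[/0]-→β* M r = subst-→β* M λ where
  zero    → r ◅ ε
  (suc k) → ε

-- An inductive characterisation of strong normalisation

apps : Term → List Term → Term
apps H []       = H
apps H (N ∷ Ns) = apps (app H N) Ns

-- In `sni-β` the reduct says nothing about `N` when the bound variable does not occur. The premises
-- on `M` and `Ns` supply the induction hypotheses for runs in which the head redex is not fired, or
-- not yet.
data SNI : Term → Set where
  sni-var : ∀ {k Ns} → All SNI Ns → SNI (apps (var k) Ns)
  sni-lam : ∀ {M} → SNI M → SNI (lam M)
  sni-⊕   : ∀ {M N Ns} → SNI (apps M Ns) → SNI (apps N Ns) → SNI (apps (M ⊕ N) Ns)
  sni-β   : ∀ {M N Ns} → SNI M → SNI N → All SNI Ns → SNI (apps (M [ N /0]) Ns) →
            SNI (apps (lam M) (N ∷ Ns))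

infix 4 _▷_ _→h_
-- Together with `_→h_` these steps lead from a term to the premises of its `SNI` rule. `▷-lam` is
-- allowed under arguments because `sni-β` asks for the body of the redex too.
data _▷_ : Term → Term → Set where
  ▷-lam : ∀ {M} Ns → apps (lam M) Ns ▷ M
  ▷-arg : ∀ {N} H Ns → N ∈ Ns → apps H Ns ▷ N
  ▷-⊕ˡ  : ∀ {M N} Ns → apps (M ⊕ N) Ns ▷ apps M Ns
  ▷-⊕ʳ  : ∀ {M N} Ns → apps (M ⊕ N) Ns ▷ apps N Ns

data _→h_ : Term → Term → Set where
  h-β : ∀ {M N} Ns → apps (lam M) (N ∷ Ns) →h apps (M [ N /0]) Ns

tsize : Term → ℕ
tsize (var k)   = 1
tsize (lam M)   = suc (tsize M)
tsize (app M N) = suc (tsize M + tsize N)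
tsize (M ⊕ N)   = suc (tsize M + tsize N)

tsizes : List Term → ℕ
tsizes []       = 0
tsizes (N ∷ Ns) = tsize N + tsizes Ns

-- The index i measures what is left to reduce: it is constant along components and drops
-- at each head reduction.
module Perpetual {I : Set} (_≺_ : I → I → Set) (G : I → Term → Set)
  (G-▷ : ∀ {i M N} → G i M → M ▷ N → G i N)
  (G-h : ∀ {i M N} → G i M → M →h N → ∃ λ j → j ≺ i × G j N) where

  mutual
    -- Lexicographic induction on the index and then on `n`, which bounds the size of head and
    -- arguments together. Moving an argument from `H` to `Ns` removes one application node, so the
    -- descent along the spine decreases as well.
    spine : ∀ {i} → Acc _≺_ i → ∀ n H Ns → tsize H + tsizes Ns < n → G i (apps H Ns) → SNI (apps H Ns)
    spine a (suc n) (var k) Ns (s≤s lt) g =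
      sni-var (args a n Ns lt (λ p → G-▷ g (▷-arg (var k) Ns p)))
    spine a (suc n) (lam M) [] (s≤s lt) g =
      sni-lam (spine a n M [] lt (G-▷ g (▷-lam [])))
    spine (acc rs) (suc n) (lam M) (N ∷ Ns) (s≤s lt) g =
      let j , j≺i , g' = G-h g (h-β Ns)
          as = args (acc rs) n (N ∷ Ns) (≤-trans (s≤s (m≤n+m _ (tsize M))) lt)
                    (λ p → G-▷ g (▷-arg (lam M) (N ∷ Ns) p))
      in sni-β (spine (acc rs) n M [] (≤-trans (s≤s (+-monoʳ-≤ (tsize M) z≤n)) lt)
                      (G-▷ g (▷-lam (N ∷ Ns))))
               (All.head as) (All.tail as)
               -- The contractum may be larger, so the size bound is chosen afresh; the index has
               -- dropped.
               (spine (rs j≺i) (suc (tsize (M [ N /0]) + tsizes Ns)) (M [ N /0]) Ns ≤-refl g')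
    spine a (suc n) (app H N) Ns (s≤s lt) g =
      spine a n H (N ∷ Ns) (≡.subst (λ z → suc z ≤ n) (+-assoc (tsize H) (tsize N) (tsizes Ns)) lt) g
    spine a (suc n) (M ⊕ N) Ns (s≤s lt) g =
      sni-⊕ {M} {N} {Ns}
            (spine a n M Ns (≤-trans (s≤s (+-monoˡ-≤ (tsizes Ns) (m≤m+n (tsize M) (tsize N)))) lt) (G-▷ g (▷-⊕ˡ Ns)))
            (spine a n N Ns (≤-trans (s≤s (+-monoˡ-≤ (tsizes Ns) (m≤n+m (tsize N) (tsize M)))) lt) (G-▷ g (▷-⊕ʳ Ns)))

    args : ∀ {i} → Acc _≺_ i → ∀ n Ns → tsizes Ns < n → (∀ {N} → N ∈ Ns → G i N) → All SNI Ns
    args a n [] lt g = []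
    args a n (N ∷ Ns) lt g =
      spine a n N [] (≤-trans (s≤s (+-monoʳ-≤ (tsize N) z≤n)) lt) (g (here refl))
      ∷ args a n Ns (≤-trans (s≤s (m≤n+m _ (tsize N))) lt) (g ∘ there)

  sni : ∀ {i M} → Acc _≺_ i → G i M → SNI M
  sni {M = M} a g = spine a (suc (tsize M + 0)) M [] ≤-refl g

-- Strong normalisation implies `SNI`

record Context (f : Term → Term) : Set where
  field
    ≈-lift : ∀ {M N} → M ≈ N → f M ≈ f N
    →β-lift : ∀ {M N} → M →β N → f M →β f N

  ⇒β-lift : ∀ {M N} → M ⇒β N → f M ⇒β f N
  ⇒β-lift (M' , N' , e , r , e') = f M' , f N' , ≈-lift e , →β-lift r , ≈-lift e'
open Context

id-context : Context id
id-context = record { ≈-lift = id ; →β-lift = id }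

∘-context : ∀ {f g} → Context f → Context g → Context (f ∘ g)
∘-context c d = record { ≈-lift = ≈-lift c ∘ ≈-lift d ; →β-lift = →β-lift c ∘ →β-lift d }

lam-context : Context lam
lam-context = record { ≈-lift = ≈-lam ; →β-lift = ξ-lam }

appˡ-context : ∀ {N} → Context (λ M → app M N)
appˡ-context = record { ≈-lift = λ e → ≈-app e ≈-refl ; →β-lift = ξ-appˡ }

appʳ-context : ∀ {M} → Context (app M)
appʳ-context = record { ≈-lift = ≈-app ≈-refl ; →β-lift = ξ-appʳ }

⊕ˡ-context : ∀ {N} → Context (_⊕ N)
⊕ˡ-context = record { ≈-lift = λ e → ≈-⊕ e ≈-refl ; →β-lift = ξ-⊕ˡ }

⊕ʳ-context : ∀ {M} → Context (M ⊕_)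
⊕ʳ-context = record { ≈-lift = ≈-⊕ ≈-refl ; →β-lift = ξ-⊕ʳ }

apps-context : ∀ Ns → Context (λ H → apps H Ns)
apps-context []       = id-context
apps-context (N ∷ Ns) = ∘-context (apps-context Ns) appˡ-context

apps-⊕ : ∀ {M N} Ns → apps (M ⊕ N) Ns ≈ apps M Ns ⊕ apps N Ns
apps-⊕ []       = ≈-refl
apps-⊕ (P ∷ Ns) = ≈-trans (≈-lift (apps-context Ns) app-⊕) (apps-⊕ Ns)

arg-context : ∀ {N} H Ns → N ∈ Ns → ∃ λ f → Context f × apps H Ns ≡ f N
arg-context H (N ∷ Ns) (here refl) = _ , ∘-context (apps-context Ns) appʳ-context , refl
arg-context H (N ∷ Ns) (there p)   = arg-context (app H N) Ns p

▷⇒context : ∀ {M N} → M ▷ N → ∃ λ f → Context f × M ≈ f N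
▷⇒context (▷-lam Ns)     = _ , ∘-context (apps-context Ns) lam-context , ≈-refl
▷⇒context (▷-arg H Ns p) with arg-context H Ns p
... | f , c , e = f , c , ≡.subst (apps H Ns ≈_) e ≈-refl
▷⇒context (▷-⊕ˡ Ns)      = _ , ⊕ˡ-context , apps-⊕ Ns
▷⇒context (▷-⊕ʳ Ns)      = _ , ⊕ʳ-context , apps-⊕ Ns

infix 4 _⊒_
-- The index for `Perpetual` is the ambient term `K`: passing to a component of `M` only enlarges
-- the context, while a head step of `M` is a step of `K`.
_⊒_ : Term → Term → Set
K ⊒ M = ∃ λ f → Context f × K ≈ f M

SN⇒SNI : ∀ {M} → SN M → SNI M
SN⇒SNI sn = Perpetual.sni (λ N M → M ⇒β N) _⊒_ ⊒-▷ ⊒-h sn (id , id-context , ≈-refl)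
  where
  ⊒-▷ : ∀ {K M N} → K ⊒ M → M ▷ N → K ⊒ N
  ⊒-▷ (f , c , e) p with ▷⇒context p
  ... | g , d , e' = f ∘ g , ∘-context c d , ≈-trans e (≈-lift c e')

  ⊒-h : ∀ {K M N} → K ⊒ M → M →h N → ∃ λ K' → K ⇒β K' × K' ⊒ N
  ⊒-h (f , c , e) (h-β Ns) =
    _ , (_ , _ , e , →β-lift c (→β-lift (apps-context Ns) β) , ≈-refl) , f , c , ≈-refl

-- SNI implies strong normalisation

-- Distributing λ and left application over ⊕ turns a term into a sum of terms without ⊕ in
-- head position; the arguments are left alone, and are only considered up to ≈.
summands : Term → List Term
summands (var k)   = [ var k ]
summands (lam M)   = map lam (summands M)
summands (app M N) = map (λ s → app s N) (summands M)
summands (M ⊕ N)   = summands M ++ summands N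

infix 4 _≅_
-- Rigid outside arguments, so that a redex on one side faces a redex on the other, which is what
-- `↣-≅` needs. Arguments stay up to `≈` because application is not linear in them.
data _≅_ : Term → Term → Set where
  ≅-var : ∀ {k} → var k ≅ var k
  ≅-lam : ∀ {s t} → s ≅ t → lam s ≅ lam t
  ≅-app : ∀ {s t N P} → s ≅ t → N ≈ P → app s N ≅ app t P
  ≅-⊕   : ∀ {s t u v} → s ≅ t → u ≅ v → s ⊕ u ≅ t ⊕ v

≅-refl : ∀ {s} → s ≅ s
≅-refl {var k}   = ≅-var
≅-refl {lam s}   = ≅-lam ≅-refl
≅-refl {app s N} = ≅-app ≅-refl ≈-refl
≅-refl {s ⊕ t}   = ≅-⊕ ≅-refl ≅-refl

≅-sym : ∀ {s t} → s ≅ t → t ≅ s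
≅-sym ≅-var       = ≅-var
≅-sym (≅-lam e)   = ≅-lam (≅-sym e)
≅-sym (≅-app e f) = ≅-app (≅-sym e) (≈-sym f)
≅-sym (≅-⊕ e f)   = ≅-⊕ (≅-sym e) (≅-sym f)

≅-trans : ∀ {s t u} → s ≅ t → t ≅ u → s ≅ u
≅-trans ≅-var       ≅-var       = ≅-var
≅-trans (≅-lam e)   (≅-lam f)   = ≅-lam (≅-trans e f)
≅-trans (≅-app e g) (≅-app f h) = ≅-app (≅-trans e f) (≈-trans g h)
≅-trans (≅-⊕ e g)   (≅-⊕ f h)   = ≅-⊕ (≅-trans e f) (≅-trans g h)

≅⇒≈ : ∀ {s t} → s ≅ t → s ≈ t
≅⇒≈ ≅-var       = ≈-refl
≅⇒≈ (≅-lam e)   = ≈-lam (≅⇒≈ e)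
≅⇒≈ (≅-app e f) = ≈-app (≅⇒≈ e) f
≅⇒≈ (≅-⊕ e f)   = ≈-⊕ (≅⇒≈ e) (≅⇒≈ f)

≅-setoid : Setoid _ _
≅-setoid = record
  { Carrier = Term ; _≈_ = _≅_
  ; isEquivalence = record { refl = ≅-refl ; sym = ≅-sym ; trans = ≅-trans } }

open import Data.List.Relation.Binary.Permutation.Setoid ≅-setoid using () renaming (_↭_ to _~_; ↭-refl to ~-refl; ↭-sym to ~-sym; ↭-trans to ~-trans; ↭-reflexive to ~-reflexive)
open import Data.List.Relation.Binary.Permutation.Setoid.Properties ≅-setoid using () renaming (++⁺ to ~-++⁺; ++-comm to ~-++-comm; map⁺ to ~-map⁺; ↭-shift to ~-shift)

-- The two distributive laws hold on the nose, as `map` commutes with `_++_`; commutativity becomes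
-- a permutation, and a change inside an argument is absorbed by `_≅_`.
≈⇒summands~ : ∀ {M N} → M ≈ N → summands M ~ summands N
≈⇒summands~ ≈-refl        = ~-refl
≈⇒summands~ (≈-sym e)     = ~-sym (≈⇒summands~ e)
≈⇒summands~ (≈-trans e f) = ~-trans (≈⇒summands~ e) (≈⇒summands~ f)
≈⇒summands~ (≈-lam e)     = ~-map⁺ ≅-setoid ≅-lam (≈⇒summands~ e)
≈⇒summands~ (≈-app {M} {M'} {N} {N'} e f) =
  ~-trans (~-map⁺ ≅-setoid (λ p → ≅-app p ≈-refl) (≈⇒summands~ e)) (args (summands M'))
  where
  args : ∀ L → map (λ s → app s N) L ~ map (λ s → app s N') L
  args []      = ~-refl
  args (s ∷ L) = Perm.prep (≅-app ≅-refl f) (args L)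
≈⇒summands~ (≈-⊕ e f)     = ~-++⁺ (≈⇒summands~ e) (≈⇒summands~ f)
≈⇒summands~ (⊕-comm {M} {N}) = ~-++-comm (summands M) (summands N)
≈⇒summands~ (⊕-assoc {M} {N} {P}) = ~-reflexive (++-assoc (summands M) (summands N) (summands P))
≈⇒summands~ (lam-⊕ {M} {N}) = ~-reflexive (map-++ lam (summands M) (summands N))
≈⇒summands~ (app-⊕ {M} {N} {P}) = ~-reflexive (map-++ (λ s → app s P) (summands M) (summands N))

infix 4 _↣_
-- A contractum can be a sum again, for instance when the head variable is replaced by a sum; hence
-- results of `↣` are split anew by `summands` wherever they are used.
data _↣_ : Term → Term → Set where
  ↣-β    : ∀ {s N} → app (lam s) N ↣ s [ N /0]
  ↣-lam  : ∀ {s s'} → s ↣ s' → lam s ↣ lam s'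
  ↣-appˡ : ∀ {s s' N} → s ↣ s' → app s N ↣ app s' N
  ↣-appʳ : ∀ {s N N'} → N ⇒β N' → app s N ↣ app s N'

↣⇒⇒β : ∀ {s s'} → s ↣ s' → s ⇒β s'
↣⇒⇒β ↣-β        = _ , _ , ≈-refl , β , ≈-refl
↣⇒⇒β (↣-lam r)  = ⇒β-lift lam-context (↣⇒⇒β r)
↣⇒⇒β (↣-appˡ r) = ⇒β-lift appˡ-context (↣⇒⇒β r)
↣⇒⇒β (↣-appʳ r) = ⇒β-lift appʳ-context r

≈-⇒β : ∀ {M N P} → M ≈ N → N ⇒β P → M ⇒β P
≈-⇒β e (M' , N' , e' , r , f) = M' , N' , ≈-trans e e' , r , f

↣-≅ : ∀ {s t t'} → s ≅ t → t ↣ t' → ∃ λ s' → s ↣ s' × s' ≈ t'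
↣-≅ (≅-app (≅-lam e) f) ↣-β    = _ , ↣-β , [/0]-≈ (≅⇒≈ e) f
↣-≅ (≅-lam e) (↣-lam r) with ↣-≅ e r
... | _ , r' , e'              = _ , ↣-lam r' , ≈-lam e'
↣-≅ (≅-app e f) (↣-appˡ r) with ↣-≅ e r
... | _ , r' , e'              = _ , ↣-appˡ r' , ≈-app e' f
↣-≅ (≅-app e f) (↣-appʳ r)     = _ , ↣-appʳ (≈-⇒β f r) , ≈-app (≅⇒≈ e) ≈-refl

infix 4 _◁_
_◁_ : Term → Term → Set
r ◁ s = ∃ λ s' → s ↣ s' × r ∈ summands s'

SNˢ : Term → Set
SNˢ = Acc _◁_

infix 4 _⟶ˢ_
data _⟶ˢ_ : List Term → List Term → Set where
  here  : ∀ {s s' L} → s ↣ s' → s ∷ L ⟶ˢ summands s' ++ L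
  there : ∀ {s L L'} → L ⟶ˢ L' → s ∷ L ⟶ˢ s ∷ L'

⟶ˢ-~ : ∀ {K L L'} → K ~ L → L ⟶ˢ L' → ∃ λ K' → K ⟶ˢ K' × K' ~ L'
⟶ˢ-~ (Perm.refl (e ∷ p)) (here r) with ↣-≅ e r
... | _ , r' , e' = _ , here r' , ~-++⁺ (≈⇒summands~ e') (Perm.refl p)
⟶ˢ-~ (Perm.refl (e ∷ p)) (there r) with ⟶ˢ-~ (Perm.refl p) r
... | _ , r' , p' = _ , there r' , Perm.prep e p'
⟶ˢ-~ (Perm.prep e p) (here r) with ↣-≅ e r
... | _ , r' , e' = _ , here r' , ~-++⁺ (≈⇒summands~ e') p
⟶ˢ-~ (Perm.prep e p) (there r) with ⟶ˢ-~ p r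
... | _ , r' , p' = _ , there r' , Perm.prep e p'
⟶ˢ-~ (Perm.swap e f p) (here r) with ↣-≅ f r
... | s' , r' , f' = _ , there (here r') ,
  ~-trans (~-sym (~-shift (summands s') _)) (~-++⁺ (≈⇒summands~ f') (Perm.prep e p))
⟶ˢ-~ (Perm.swap e f p) (there (here {s' = t'} r)) with ↣-≅ e r
... | s' , r' , e' = _ , here r' ,
  ~-trans (~-++⁺ (≈⇒summands~ e') (Perm.prep f p)) (~-shift (summands t') _)
⟶ˢ-~ (Perm.swap e f p) (there (there r)) with ⟶ˢ-~ p r
... | _ , r' , p' = _ , there (there r') , Perm.swap e f p'
⟶ˢ-~ (Perm.trans p q) r with ⟶ˢ-~ q r
... | _ , r' , q' with ⟶ˢ-~ p r'
... | _ , r″ , p' = _ , r″ , ~-trans p' q'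

infix 4 _⟶ˢ⁺_
_⟶ˢ⁺_ : List Term → List Term → Set
L ⟶ˢ⁺ L″ = ∃ λ L' → L ⟶ˢ L' × Star _⟶ˢ_ L' L″

⟶ˢ*-~ : ∀ {K L L'} → K ~ L → Star _⟶ˢ_ L L' → ∃ λ K' → Star _⟶ˢ_ K K' × K' ~ L'
⟶ˢ*-~ p ε = _ , ε , p
⟶ˢ*-~ p (r ◅ rs) with ⟶ˢ-~ p r
... | _ , r' , p' with ⟶ˢ*-~ p' rs
... | _ , rs' , p″ = _ , r' ◅ rs' , p″

⟶ˢ⁺-~ : ∀ {K L L'} → K ~ L → L ⟶ˢ⁺ L' → ∃ λ K' → K ⟶ˢ⁺ K' × K' ~ L'
⟶ˢ⁺-~ p (_ , r , rs) with ⟶ˢ-~ p r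
... | _ , r' , p' with ⟶ˢ*-~ p' rs
... | _ , rs' , p″ = _ , (_ , r' , rs') , p″

⟶ˢ⁺-map : ∀ {f : List Term → List Term} → (∀ {L L'} → L ⟶ˢ L' → f L ⟶ˢ f L') →
          ∀ {L L'} → L ⟶ˢ⁺ L' → f L ⟶ˢ⁺ f L'
⟶ˢ⁺-map g (_ , r , rs) = _ , g r , gmap _ g rs

⟶ˢ-++ʳ : ∀ K {L L'} → L ⟶ˢ L' → L ++ K ⟶ˢ L' ++ K
⟶ˢ-++ʳ K (here {s} {s'} {L} r) =
  ≡.subst (s ∷ L ++ K ⟶ˢ_) (≡.sym (++-assoc (summands s') L K)) (here r)
⟶ˢ-++ʳ K (there r) = there (⟶ˢ-++ʳ K r)

⟶ˢ-++ˡ : ∀ K {L L'} → L ⟶ˢ L' → K ++ L ⟶ˢ K ++ L'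
⟶ˢ-++ˡ []      r = r
⟶ˢ-++ˡ (s ∷ K) r = there (⟶ˢ-++ˡ K r)

⟶ˢ-lift : ∀ (f : Term → Term) → (∀ {s s'} → s ↣ s' → f s ↣ f s') →
          (∀ s → summands (f s) ≡ map f (summands s)) →
          ∀ {L L'} → L ⟶ˢ L' → map f L ⟶ˢ map f L'
⟶ˢ-lift f ↣-f summands-f (here {s} {s'} {L} r) =
  ≡.subst (f s ∷ map f L ⟶ˢ_)
    (≡.trans (cong (_++ map f L) (summands-f s')) (≡.sym (map-++ f (summands s') L)))
    (here (↣-f r))
⟶ˢ-lift f ↣-f summands-f (there r) = there (⟶ˢ-lift f ↣-f summands-f r)

⟶ˢ*-each : ∀ (f g : Term → Term) → (∀ {s} → f s ↣ g s) →
           ∀ L → Star _⟶ˢ_ (map f L) (concatMap (summands ∘ g) L)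
⟶ˢ*-each f g r []      = ε
⟶ˢ*-each f g r (s ∷ L) = here r ◅ gmap (summands (g s) ++_) (⟶ˢ-++ˡ (summands (g s))) (⟶ˢ*-each f g r L)

⟶ˢ⁺-each : ∀ (f g : Term → Term) → (∀ {s} → f s ↣ g s) →
           ∀ s L → map f (s ∷ L) ⟶ˢ⁺ concatMap (summands ∘ g) (s ∷ L)
⟶ˢ⁺-each f g r s L =
  _ , here r , gmap (summands (g s) ++_) (⟶ˢ-++ˡ (summands (g s))) (⟶ˢ*-each f g r L)

summands-nonempty : ∀ M → ∃ λ s → ∃ λ L → summands M ≡ s ∷ L
summands-nonempty (var k)   = _ , _ , refl
summands-nonempty (lam M)   with summands M | summands-nonempty M
... | _ | _ , _ , refl      = _ , _ , refl
summands-nonempty (app M N) with summands M | summands-nonempty M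
... | _ | _ , _ , refl      = _ , _ , refl
summands-nonempty (M ⊕ N)   with summands M | summands-nonempty M
... | _ | _ , _ , refl      = _ , _ , refl

⟶ˢ⁺-eachˢ : ∀ (f g : Term → Term) → (∀ {s} → f s ↣ g s) →
            ∀ M → map f (summands M) ⟶ˢ⁺ concatMap (summands ∘ g) (summands M)
⟶ˢ⁺-eachˢ f g r M with summands M | summands-nonempty M
... | _ | s , L , refl = ⟶ˢ⁺-each f g r s L

-- Substituting into a summand may bring a sum into head position, hence the second splitting.
summands-subst : ∀ σ M → summands (subst σ M) ≡ concatMap (summands ∘ subst σ) (summands M)
summands-subst σ (var k) = ≡.sym (++-identityʳ (summands (σ k)))
summands-subst σ (lam M) = begin
  map lam (summands (subst (exts σ) M))                         ≡⟨ cong (map lam) (summands-subst (exts σ) M) ⟩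
  map lam (concatMap (summands ∘ subst (exts σ)) (summands M))  ≡⟨ map-concatMap lam _ (summands M) ⟩
  concatMap (summands ∘ subst σ ∘ lam) (summands M)             ≡⟨ concatMap-map (summands ∘ subst σ) lam (summands M) ⟨
  concatMap (summands ∘ subst σ) (map lam (summands M))         ∎
  where open ≡.≡-Reasoning
summands-subst σ (app M N) = begin
  map (λ s → app s (subst σ N)) (summands (subst σ M))                       ≡⟨ cong (map (λ s → app s (subst σ N))) (summands-subst σ M) ⟩
  map (λ s → app s (subst σ N)) (concatMap (summands ∘ subst σ) (summands M)) ≡⟨ map-concatMap _ _ (summands M) ⟩
  concatMap (summands ∘ subst σ ∘ (λ s → app s N)) (summands M)              ≡⟨ concatMap-map (summands ∘ subst σ) (λ s → app s N) (summands M) ⟨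
  concatMap (summands ∘ subst σ) (map (λ s → app s N) (summands M))          ∎
  where open ≡.≡-Reasoning
summands-subst σ (M ⊕ N) =
  ≡.trans (cong₂ _++_ (summands-subst σ M) (summands-subst σ N))
          (≡.sym (concatMap-++ (summands ∘ subst σ) (summands M) (summands N)))

summands-idem : ∀ M → concatMap summands (summands M) ≡ summands M
summands-idem M = begin
  concatMap summands (summands M)                ≡⟨ concatMap-cong (λ s → cong summands (≡.sym (subst-var s))) (summands M) ⟩
  concatMap (summands ∘ subst var) (summands M)  ≡⟨ summands-subst var M ⟨
  summands (subst var M)                         ≡⟨ cong summands (subst-var M) ⟩
  summands M                                     ∎
  where open ≡.≡-Reasoning

-- Distributing over sums duplicates what is reduced: contracting `app (lam M) N` fires one redex
-- per summand of `M`, and a step in an argument is repeated in all its copies. At least one step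
-- results since no list of summands is empty, so termination transfers back.
→β⇒⟶ˢ⁺ : ∀ {M M'} → M →β M' → summands M ⟶ˢ⁺ summands M'
→β⇒⟶ˢ⁺ (β {M} {N}) =
  ≡.subst₂ _⟶ˢ⁺_ (map-∘ (summands M)) (≡.sym (summands-subst (σ₀ N) M))
    (⟶ˢ⁺-eachˢ (λ s → app (lam s) N) (_[ N /0]) ↣-β M)
→β⇒⟶ˢ⁺ (ξ-lam r)  = ⟶ˢ⁺-map (⟶ˢ-lift lam ↣-lam (λ _ → refl)) (→β⇒⟶ˢ⁺ r)
→β⇒⟶ˢ⁺ (ξ-appˡ {N = N} r) = ⟶ˢ⁺-map (⟶ˢ-lift (λ s → app s N) ↣-appˡ (λ _ → refl)) (→β⇒⟶ˢ⁺ r)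
→β⇒⟶ˢ⁺ (ξ-appʳ {M} {N} {N'} r) =
  ≡.subst (map (λ s → app s N) (summands M) ⟶ˢ⁺_)
    (≡.trans (≡.sym (map-concatMap (λ s → app s N') summands (summands M)))
             (cong (map (λ s → app s N')) (summands-idem M)))
    (⟶ˢ⁺-eachˢ (λ s → app s N) (λ s → app s N') (↣-appʳ (_ , _ , ≈-refl , r , ≈-refl)) M)
→β⇒⟶ˢ⁺ (ξ-⊕ˡ {N = N} r) = ⟶ˢ⁺-map (⟶ˢ-++ʳ (summands N)) (→β⇒⟶ˢ⁺ r)
→β⇒⟶ˢ⁺ (ξ-⊕ʳ {M = M} r) = ⟶ˢ⁺-map (⟶ˢ-++ˡ (summands M)) (→β⇒⟶ˢ⁺ r)

-- Termination of lists of summands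

SNˡ : List Term → Set
SNˡ = Acc (λ L' L → L ⟶ˢ L')

mutual
  SNˡ⇒SN : ∀ {L M} → SNˡ L → L ~ summands M → SN M
  SNˡ⇒SN {L} a p = acc λ r → reduct a p r
    where
    reduct : ∀ {L M M'} → SNˡ L → L ~ summands M → M ⇒β M' → SN M'
    reduct (acc h) p (_ , _ , e , r , e') with ⟶ˢ⁺-~ (~-trans p (≈⇒summands~ e)) (→β⇒⟶ˢ⁺ r)
    ... | _ , (_ , r' , rs) , p' = SNˡ*⇒SN (h r') rs (~-trans p' (≈⇒summands~ e'))

  SNˡ*⇒SN : ∀ {L L' M} → SNˡ L → Star _⟶ˢ_ L L' → L' ~ summands M → SN M
  SNˡ*⇒SN a       ε        p = SNˡ⇒SN a p
  SNˡ*⇒SN (acc h) (r ◅ rs) p = SNˡ*⇒SN (h r) rs p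

mutual
  -- The multiset order in disguise, by induction on `s` and then `L`. A step in `s` replaces it by
  -- finitely many terms that are below `s` for `_◁_`, and these can be put back in front of `L` one
  -- at a time although the list grows.
  SNˡ-∷ : ∀ {s L} → SNˢ s → SNˡ L → SNˡ (s ∷ L)
  SNˡ-∷ a b = acc λ r → SNˡ-reduct a b r

  SNˡ-reduct : ∀ {s L L'} → SNˢ s → SNˡ L → s ∷ L ⟶ˢ L' → SNˡ L'
  SNˡ-reduct (acc f) b       (here {s' = s'} r) = SNˡ-++ f b (summands s') (λ q → _ , r , q)
  SNˡ-reduct a       (acc g) (there r)          = SNˡ-∷ a (g r)

  SNˡ-++ : ∀ {s L} → (∀ {q} → q ◁ s → SNˢ q) → SNˡ L → ∀ K → (∀ {q} → q ∈ K → q ◁ s) → SNˡ (K ++ L)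
  SNˡ-++ f b []      sub = b
  SNˡ-++ f b (q ∷ K) sub = SNˡ-∷ (f (sub (here refl))) (SNˡ-++ f b K (sub ∘ there))

All-SNˢ⇒SNˡ : ∀ {L} → All SNˢ L → SNˡ L
All-SNˢ⇒SNˡ []       = acc λ ()
All-SNˢ⇒SNˡ (a ∷ as) = SNˡ-∷ a (All-SNˢ⇒SNˡ as)

summands⇒SN : ∀ M → All SNˢ (summands M) → SN M
summands⇒SN M as = SNˡ⇒SN (All-SNˢ⇒SNˡ as) ~-refl

summand-⊕ : ∀ {s} M → s ∈ summands M → (M ≈ s) ⊎ (∃ λ P → M ≈ s ⊕ P)
summand-⊕ (var k) (here refl) = inj₁ ≈-refl
summand-⊕ (lam M) p with ∈-map⁻ lam p
... | _ , q , refl with summand-⊕ M q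
... | inj₁ e       = inj₁ (≈-lam e)
... | inj₂ (P , e) = inj₂ (_ , ≈-trans (≈-lam e) lam-⊕)
summand-⊕ (app M N) p with ∈-map⁻ (λ s → app s N) p
... | _ , q , refl with summand-⊕ M q
... | inj₁ e       = inj₁ (≈-app e ≈-refl)
... | inj₂ (P , e) = inj₂ (_ , ≈-trans (≈-app e ≈-refl) app-⊕)
summand-⊕ (M ⊕ N) p with ∈-++⁻ (summands M) p
... | inj₁ q with summand-⊕ M q
...   | inj₁ e       = inj₂ (N , ≈-⊕ e ≈-refl)
...   | inj₂ (P , e) = inj₂ (_ , ≈-trans (≈-⊕ e ≈-refl) ⊕-assoc)
summand-⊕ (M ⊕ N) p | inj₂ q with summand-⊕ N q
...   | inj₁ e       = inj₂ (M , ≈-trans ⊕-comm (≈-⊕ e ≈-refl))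
...   | inj₂ (P , e) = inj₂ (_ , ≈-trans ⊕-comm (≈-trans (≈-⊕ e ≈-refl) ⊕-assoc))

SN-≈ : ∀ {M N} → M ≈ N → SN M → SN N
SN-≈ e (acc h) = acc λ r → h (≈-⇒β e r)

SN-context : ∀ {f M} → Context f → SN (f M) → SN M
SN-context c (acc h) = acc λ r → SN-context c (h (⇒β-lift c r))

SN-⇒β : ∀ {M N} → M ⇒β N → SN M → SN N
SN-⇒β r (acc h) = h r

SN-→β* : ∀ {M N} → Star _→β_ M N → SN M → SN N
SN-→β* ε        a = a
SN-→β* (r ◅ rs) a = SN-→β* rs (SN-⇒β (_ , _ , ≈-refl , r , ≈-refl) a)

SN-summand : ∀ {s M} → SN M → s ∈ summands M → SN s
SN-summand {M = M} a p with summand-⊕ M p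
... | inj₁ e       = SN-≈ e a
... | inj₂ (P , e) = SN-context ⊕ˡ-context (SN-≈ e a)

-- The induction runs on an ambient `M`: a reduct of `s` may split, but each of its summands still
-- sits in the reduct of `M`, with the other summands joining the context.
SN⇒SNˢ : ∀ {M s} → SN M → M ⊒ s → SNˢ s
SN⇒SNˢ (acc h) (f , c , e) = acc λ where
    (s' , r , q) → SN⇒SNˢ (h (≈-⇒β e (⇒β-lift c (↣⇒⇒β r)))) (below c q)
  where
  below : ∀ {f s' q} → Context f → q ∈ summands s' → f s' ⊒ q
  below {s' = s'} c q with summand-⊕ s' q
  ... | inj₁ e       = _ , c , ≈-lift c e
  ... | inj₂ (P , e) = _ , ∘-context c ⊕ˡ-context , ≈-lift c e

SN⇒summands : ∀ {M} → SN M → All SNˢ (summands M)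
SN⇒summands a = All.tabulate λ p → SN⇒SNˢ (SN-summand a p) (id , id-context , ≈-refl)

-- Spines, head expansion, and `SNI` implies `SN`

infix 4 _⇒ᵃ_
data _⇒ᵃ_ : List Term → List Term → Set where
  here  : ∀ {N N' Ns} → N ⇒β N' → N ∷ Ns ⇒ᵃ N' ∷ Ns
  there : ∀ {N Ns Ns'} → Ns ⇒ᵃ Ns' → N ∷ Ns ⇒ᵃ N ∷ Ns'

SNᵃ : List Term → Set
SNᵃ = Acc (λ Ns' Ns → Ns ⇒ᵃ Ns')

SNᵃ-∷ : ∀ {N Ns} → SN N → SNᵃ Ns → SNᵃ (N ∷ Ns)
SNᵃ-∷ (acc f) (acc g) = acc λ where
  (here r)  → SNᵃ-∷ (f r) (acc g)
  (there r) → SNᵃ-∷ (acc f) (g r)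

All-SN⇒SNᵃ : ∀ {Ns} → All SN Ns → SNᵃ Ns
All-SN⇒SNᵃ []       = acc λ ()
All-SN⇒SNᵃ (a ∷ as) = SNᵃ-∷ a (All-SN⇒SNᵃ as)

⇒ᵃ⇒⇒β : ∀ {H Ns Ns'} → Ns ⇒ᵃ Ns' → apps H Ns ⇒β apps H Ns'
⇒ᵃ⇒⇒β (here {Ns = Ns} r) = ⇒β-lift (apps-context Ns) (⇒β-lift appʳ-context r)
⇒ᵃ⇒⇒β (there r)          = ⇒ᵃ⇒⇒β r

summands-apps : ∀ H Ns → summands (apps H Ns) ≡ map (λ h → apps h Ns) (summands H)
summands-apps H []       = ≡.sym (map-id (summands H))
summands-apps H (N ∷ Ns) = ≡.trans (summands-apps (app H N) Ns) (≡.sym (map-∘ (summands H)))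

∈-summands-apps : ∀ {r} H Ns → r ∈ summands (apps H Ns) → ∃ λ h → h ∈ summands H × r ≡ apps h Ns
∈-summands-apps H Ns p = ∈-map⁻ (λ h → apps h Ns) (≡.subst (_ ∈_) (summands-apps H Ns) p)

apps-↣⁻ : ∀ {H} Ns {X} → (∀ {s} → ¬ H ≡ lam s) → apps H Ns ↣ X →
          (∃ λ H' → H ↣ H' × X ≡ apps H' Ns) ⊎ (∃ λ Ns' → Ns ⇒ᵃ Ns' × X ≡ apps H Ns')
apps-↣⁻ []       ¬lam r = inj₁ (_ , r , refl)
apps-↣⁻ (N ∷ Ns) ¬lam r with apps-↣⁻ Ns (λ ()) r
... | inj₁ (_ , ↣-β , e)       with () ← ¬lam refl
... | inj₁ (_ , ↣-appˡ r' , e) = inj₁ (_ , r' , e)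
... | inj₁ (_ , ↣-appʳ r' , e) = inj₂ (_ , here r' , e)
... | inj₂ (_ , r' , e)        = inj₂ (_ , there r' , e)

SNᵃ⇒SNˢ-var : ∀ {k Ns} → SNᵃ Ns → SNˢ (apps (var k) Ns)
SNᵃ⇒SNˢ-var {k} {Ns} (acc h) = acc λ where (_ , r , q) → reduct r q
  where
  reduct : ∀ {X r} → apps (var k) Ns ↣ X → r ∈ summands X → SNˢ r
  reduct r q with apps-↣⁻ Ns (λ ()) r
  ... | inj₂ (Ns' , r' , refl) with ∈-summands-apps (var k) Ns' q
  ... | _ , here refl , refl = SNᵃ⇒SNˢ-var (h r')

SNˢ-lam : ∀ {s} → SNˢ s → SNˢ (lam s)
SNˢ-lam (acc h) = acc λ where (_ , ↣-lam r , q) → reduct r q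
  where
  reduct : ∀ {s' r} → _ ↣ s' → r ∈ summands (lam s') → SNˢ r
  reduct r q with ∈-map⁻ lam q
  ... | _ , q' , refl = SNˢ-lam (h (_ , r , q'))

summand-[/0] : ∀ {q} s' N Ns → q ∈ summands s' → SN (apps (s' [ N /0]) Ns) → SN (apps (q [ N /0]) Ns)
summand-[/0] s' N Ns p a with summand-⊕ s' p
... | inj₁ e       = SN-≈ (≈-lift (apps-context Ns) (subst-≈ e)) a
... | inj₂ (P , e) = SN-context ⊕ˡ-context
  (SN-≈ (≈-trans (≈-lift (apps-context Ns) (subst-≈ e)) (apps-⊕ Ns)) a)

subst-⇒β : ∀ {σ M M'} → M ⇒β M' → subst σ M ⇒β subst σ M'
subst-⇒β (_ , _ , e , r , e') = _ , _ , subst-≈ e , subst-→β r , subst-≈ e'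

SN-[/0]-⇒β : ∀ s {N N'} Ns → N ⇒β N' → SN (apps (s [ N /0]) Ns) → SN (apps (s [ N' /0]) Ns)
SN-[/0]-⇒β s Ns (_ , _ , e , r , e') a =
  SN-≈ (≈-lift (apps-context Ns) ([/0]-≈ {s} ≈-refl e'))
    (SN-→β* (gmap (λ H → apps H Ns) (→β-lift (apps-context Ns)) ([/0]-→β* s r))
      (SN-≈ (≈-lift (apps-context Ns) ([/0]-≈ {s} ≈-refl e)) a))

Simple : Term → Set
Simple s = summands s ≡ [ s ]

∈summands⇒Simple : ∀ {s} M → s ∈ summands M → Simple s
∈summands⇒Simple (var k) (here refl) = refl
∈summands⇒Simple (lam M) p with ∈-map⁻ lam p
... | _ , q , refl = cong (map lam) (∈summands⇒Simple M q)
∈summands⇒Simple (app M N) p with ∈-map⁻ (λ s → app s N) p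
... | _ , q , refl = cong (map (λ s → app s N)) (∈summands⇒Simple M q)
∈summands⇒Simple (M ⊕ N) p with ∈-++⁻ (summands M) p
... | inj₁ q = ∈summands⇒Simple M q
... | inj₂ q = ∈summands⇒Simple N q

-- Simultaneous induction on `s`, `N` and `Ns`, with strong normalisation of the contractum as an
-- invariant. A step in `N` becomes any number of steps in the contractum, possibly none, so the
-- contractum alone could not serve as the measure. A step in `s` may produce a sum, whose summands
-- are treated separately.
head-expansion : ∀ {s N Ns} → Simple s → SNˢ s → SN N → SNᵃ Ns →
                 SN (apps (s [ N /0]) Ns) → SNˢ (apps (lam s) (N ∷ Ns))
head-expansion {s} {N} {Ns} simple (acc f) (acc g) (acc h) a = acc λ where (_ , r , q) → reduct r q
  where
  ∈-simple : ∀ {r} N' Ns' → r ∈ summands (apps (lam s) (N' ∷ Ns')) → r ≡ apps (lam s) (N' ∷ Ns')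
  ∈-simple N' Ns' q with ∈-summands-apps (lam s) (N' ∷ Ns') q
  ... | _ , q' , refl with ∈-map⁻ lam (≡.subst (λ L → _ ∈ map lam L) simple q')
  ... | _ , here refl , refl = refl

  reduct : ∀ {X r} → apps (lam s) (N ∷ Ns) ↣ X → r ∈ summands X → SNˢ r
  -- The head is taken to be `app (lam s) N` and not `lam s`, so that firing the redex counts as a
  -- step of the head.
  reduct r q with apps-↣⁻ {app (lam s) N} Ns (λ ()) r
  ... | inj₁ (_ , ↣-β , refl) = All.lookup (SN⇒summands a) q
  ... | inj₁ (_ , ↣-appˡ (↣-lam {s' = s'} r') , refl) with ∈-summands-apps (lam s') (N ∷ Ns) q
  ...   | _ , q' , refl with ∈-map⁻ lam q'
  ...   | _ , q″ , refl =
    head-expansion (∈summands⇒Simple s' q″) (f (_ , r' , q″)) (acc g) (acc h)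
      (summand-[/0] s' N Ns q″ (SN-⇒β (⇒β-lift (apps-context Ns) (subst-⇒β (↣⇒⇒β r'))) a))
  reduct r q | inj₁ (_ , ↣-appʳ {N' = N'} r' , refl) with ∈-simple N' Ns q
  ...   | refl = head-expansion simple (acc f) (g r') (acc h) (SN-[/0]-⇒β s Ns r' a)
  reduct r q | inj₂ (Ns' , r' , refl) with ∈-simple N Ns' q
  ...   | refl = head-expansion simple (acc f) (acc g) (h r') (SN-⇒β (⇒ᵃ⇒⇒β r') a)

mutual
  SNI⇒SN : ∀ {M} → SNI M → SN M
  SNI⇒SN (sni-var {k} {Ns} as) = summands⇒SN (apps (var k) Ns) (All.tabulate λ p → spine p)
    where
    args = All-SN⇒SNᵃ (All-SNI⇒SN as)
    spine : ∀ {r} → r ∈ summands (apps (var k) Ns) → SNˢ r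
    spine p with ∈-summands-apps (var k) Ns p
    ... | _ , here refl , refl = SNᵃ⇒SNˢ-var args
  SNI⇒SN (sni-lam {M} a) =
    summands⇒SN (lam M) (All.map⁺ (All.map SNˢ-lam (SN⇒summands (SNI⇒SN a))))
  SNI⇒SN (sni-⊕ {M} {N} {Ns} a b) = SN-≈ (≈-sym (apps-⊕ Ns))
    (summands⇒SN (apps M Ns ⊕ apps N Ns) (All.++⁺ (SN⇒summands (SNI⇒SN a))
                                      (SN⇒summands (SNI⇒SN b))))
  SNI⇒SN (sni-β {M} {N} {Ns} a b cs d) =
    summands⇒SN (apps (lam M) (N ∷ Ns)) (All.tabulate λ p → spine p)
    where
    a' = SN⇒summands (SNI⇒SN a)
    b' = SNI⇒SN b
    cs' = All-SN⇒SNᵃ (All-SNI⇒SN cs)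
    d' = SNI⇒SN d
    spine : ∀ {r} → r ∈ summands (apps (lam M) (N ∷ Ns)) → SNˢ r
    spine p with ∈-summands-apps (lam M) (N ∷ Ns) p
    ... | _ , q , refl with ∈-map⁻ lam q
    ... | _ , q' , refl =
      head-expansion (∈summands⇒Simple M q') (All.lookup a' q') b' cs' (summand-[/0] M N Ns q' d')

  All-SNI⇒SN : ∀ {Ns} → All SNI Ns → All SN Ns
  All-SNI⇒SN []       = []
  All-SNI⇒SN (a ∷ as) = SNI⇒SN a ∷ All-SNI⇒SN as

-- Differential substitution and resource reduction as relations

mutual
  rrename-cong : ∀ {ρ ρ'} → ρ ≗ ρ' → rrename ρ ≗ rrename ρ'
  rrename-cong e (rvar k)   = cong rvar (e k)
  rrename-cong e (rlam s)   = cong rlam (rrename-cong (ext-cong e) s)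
  rrename-cong e (rapp s b) = cong₂ rapp (rrename-cong e s) (rrenameᵇ-cong e b)

  rrenameᵇ-cong : ∀ {ρ ρ'} → ρ ≗ ρ' → rrenameᵇ ρ ≗ rrenameᵇ ρ'
  rrenameᵇ-cong e []      = refl
  rrenameᵇ-cong e (t ∷ b) = cong₂ _∷_ (rrename-cong e t) (rrenameᵇ-cong e b)

mutual
  rrename-∘ : ∀ ρ ρ' s → rrename ρ (rrename ρ' s) ≡ rrename (ρ ∘ ρ') s
  rrename-∘ ρ ρ' (rvar k)   = refl
  rrename-∘ ρ ρ' (rlam s)   =
    cong rlam (≡.trans (rrename-∘ (ext ρ) (ext ρ') s) (rrename-cong (ext-∘ ρ ρ') s))
  rrename-∘ ρ ρ' (rapp s b) = cong₂ rapp (rrename-∘ ρ ρ' s) (rrenameᵇ-∘ ρ ρ' b)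

  rrenameᵇ-∘ : ∀ ρ ρ' b → rrenameᵇ ρ (rrenameᵇ ρ' b) ≡ rrenameᵇ (ρ ∘ ρ') b
  rrenameᵇ-∘ ρ ρ' []      = refl
  rrenameᵇ-∘ ρ ρ' (t ∷ b) = cong₂ _∷_ (rrename-∘ ρ ρ' t) (rrenameᵇ-∘ ρ ρ' b)

rrenameᵇ-++ : ∀ ρ b c → rrenameᵇ ρ (b ++ c) ≡ rrenameᵇ ρ b ++ rrenameᵇ ρ c
rrenameᵇ-++ ρ []      c = refl
rrenameᵇ-++ ρ (t ∷ b) c = cong (rrename ρ t ∷_) (rrenameᵇ-++ ρ b c)

rrenameᵇ-↭ : ∀ {ρ b c} → b ↭ c → rrenameᵇ ρ b ↭ rrenameᵇ ρ c
rrenameᵇ-↭ refl         = refl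
rrenameᵇ-↭ (prep t p)   = prep _ (rrenameᵇ-↭ p)
rrenameᵇ-↭ (swap t u p) = swap _ _ (rrenameᵇ-↭ p)
rrenameᵇ-↭ (trans p q)  = trans (rrenameᵇ-↭ p) (rrenameᵇ-↭ q)

-- Sub d us t t': t' is one of the terms of t⟨us/x⟩, where x is the variable of index d; the
-- permutation f ∈ Sₙ appears as an arbitrary splitting of us at each application node.
data Sub  : ℕ → List RTerm → RTerm → RTerm → Set
data Subᵇ : ℕ → List RTerm → Bag → Bag → Set

data Sub where
  sub-≡   : ∀ {d u} → Sub d [ u ] (rvar d) (rrename (d +_) u)
  sub-<   : ∀ {d k} → k < d → Sub d [] (rvar k) (rvar k)
  sub->   : ∀ {d k} → d ≤ k → Sub d [] (rvar (suc k)) (rvar k)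
  sub-lam : ∀ {d us s s'} → Sub (suc d) us s s' → Sub d us (rlam s) (rlam s')
  sub-app : ∀ {d us vs ws s s' b b'} → Sub d us s s' → Subᵇ d vs b b' → ws ↭ us ++ vs →
            Sub d ws (rapp s b) (rapp s' b')

data Subᵇ where
  sub-[] : ∀ {d} → Subᵇ d [] [] []
  sub-∷  : ∀ {d us vs ws t t' b b'} → Sub d us t t' → Subᵇ d vs b b' → ws ↭ us ++ vs →
           Subᵇ d ws (t ∷ b) (t' ∷ b')

sub-var⁻ : ∀ {d us k t} → Sub d us (rvar k) t →
           (∃ λ u → k ≡ d × us ≡ [ u ] × t ≡ rrename (d +_) u)
           ⊎ (k < d × us ≡ [] × t ≡ rvar k)
           ⊎ (∃ λ j → k ≡ suc j × d ≤ j × us ≡ [] × t ≡ rvar j)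
sub-var⁻ sub-≡     = inj₁ (_ , refl , refl , refl)
sub-var⁻ (sub-< p) = inj₂ (inj₁ (p , refl , refl))
sub-var⁻ (sub-> p) = inj₂ (inj₂ (_ , refl , p , refl , refl))

Sub-↭ : ∀ {d us vs t t'} → us ↭ vs → Sub d us t t' → Sub d vs t t'
Sub-↭ p sub-≡           with refl ← ↭-singleton-inv (↭-sym p) = sub-≡
Sub-↭ p (sub-< q)       with refl ← ↭-empty-inv (↭-sym p) = sub-< q
Sub-↭ p (sub-> q)       with refl ← ↭-empty-inv (↭-sym p) = sub-> q
Sub-↭ p (sub-lam h)     = sub-lam (Sub-↭ p h)
Sub-↭ p (sub-app h k q) = sub-app h k (↭-trans (↭-sym p) q)

Subᵇ-↭ᵇ : ∀ {d us b b' c} → b ↭ c → Subᵇ d us b b' → ∃ λ c' → Subᵇ d us c c' × b' ↭ c'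
Subᵇ-↭ᵇ refl h = _ , h , refl
Subᵇ-↭ᵇ (prep t p) (sub-∷ h k q) with Subᵇ-↭ᵇ p k
... | _ , k' , p' = _ , sub-∷ h k' q , prep _ p'
Subᵇ-↭ᵇ (swap t u p) (sub-∷ {us = us₁} h₁ (sub-∷ {us = us₂} h₂ k q₂) q₁) with Subᵇ-↭ᵇ p k
... | _ , k' , p' = _ ,
  sub-∷ h₂ (sub-∷ h₁ k' refl) (↭-trans q₁ (↭-trans (++⁺ˡ us₁ q₂) (shifts us₁ us₂))) , swap _ _ p'
Subᵇ-↭ᵇ (trans p q) h with Subᵇ-↭ᵇ p h
... | _ , h' , p' with Subᵇ-↭ᵇ q h'
... | _ , h″ , q' = _ , h″ , trans p' q'

interchange : ∀ (as bs cs ds : List RTerm) → (as ++ bs) ++ (cs ++ ds) ↭ (as ++ cs) ++ (bs ++ ds)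
interchange as bs cs ds =
  ↭-trans (↭-reflexive (++-assoc as bs (cs ++ ds)))
    (↭-trans (++⁺ˡ as (shifts bs cs)) (↭-reflexive (≡.sym (++-assoc as cs (bs ++ ds)))))

Subᵇ-++ : ∀ {d us vs b b' c c'} → Subᵇ d us b b' → Subᵇ d vs c c' → Subᵇ d (us ++ vs) (b ++ c) (b' ++ c')
Subᵇ-++ sub-[] k = k
Subᵇ-++ {vs = vs} (sub-∷ {us = us₁} {us₂} h h' q) k =
  sub-∷ h (Subᵇ-++ h' k) (↭-trans (++⁺ʳ vs q) (↭-reflexive (++-assoc us₁ us₂ vs)))

extⁿ : ℕ → (ℕ → ℕ) → ℕ → ℕ
extⁿ zero    ρ = ρ
extⁿ (suc d) ρ = ext (extⁿ d ρ)

extⁿ-< : ∀ {d ρ k} → k < d → extⁿ d ρ k ≡ k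
extⁿ-< {suc d} {k = zero}  p       = refl
extⁿ-< {suc d} {k = suc k} (s≤s p) = cong suc (extⁿ-< p)

extⁿ-+ : ∀ d ρ k → extⁿ d ρ (d + k) ≡ d + ρ k
extⁿ-+ zero    ρ k = refl
extⁿ-+ (suc d) ρ k = cong suc (extⁿ-+ d ρ k)

extⁿ-≥ : ∀ {d ρ k} → d ≤ k → d ≤ extⁿ d ρ k
extⁿ-≥ {zero}              p       = z≤n
extⁿ-≥ {suc d} {k = suc k} (s≤s p) = s≤s (extⁿ-≥ p)

mutual
  Sub-rename : ∀ {d us t t'} ρ → Sub d us t t' →
               Sub d (rrenameᵇ ρ us) (rrename (extⁿ (suc d) ρ) t) (rrename (extⁿ d ρ) t')
  Sub-rename {d} ρ (sub-≡ {u = u}) = ≡.subst₂ (Sub d [ rrename ρ u ])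
    (cong rvar (≡.sym (extⁿ-< {suc d} (n<1+n d))))
    (begin
      rrename (d +_) (rrename ρ u)           ≡⟨ rrename-∘ (d +_) ρ u ⟩
      rrename ((d +_) ∘ ρ) u                 ≡⟨ rrename-cong (λ k → ≡.sym (extⁿ-+ d ρ k)) u ⟩
      rrename (extⁿ d ρ ∘ (d +_)) u          ≡⟨ rrename-∘ (extⁿ d ρ) (d +_) u ⟨
      rrename (extⁿ d ρ) (rrename (d +_) u)  ∎)
    sub-≡
    where open ≡.≡-Reasoning
  Sub-rename {d} ρ (sub-< {k = k} p)
    rewrite extⁿ-< {d} {ρ} p | extⁿ-< {suc d} {ρ} (m<n⇒m<1+n p) = sub-< p
  Sub-rename {d} ρ (sub-> p)       = sub-> (extⁿ-≥ p)
  Sub-rename ρ (sub-lam h)         = sub-lam (Sub-rename ρ h)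
  Sub-rename ρ (sub-app {us = us} {vs} h k q) =
    sub-app (Sub-rename ρ h) (Subᵇ-rename ρ k) (≡.subst (_ ↭_) (rrenameᵇ-++ ρ us vs) (rrenameᵇ-↭ q))

  Subᵇ-rename : ∀ {d us b b'} ρ → Subᵇ d us b b' →
                Subᵇ d (rrenameᵇ ρ us) (rrenameᵇ (extⁿ (suc d) ρ) b) (rrenameᵇ (extⁿ d ρ) b')
  Subᵇ-rename ρ sub-[] = sub-[]
  Subᵇ-rename ρ (sub-∷ {us = us} {vs} h k q) =
    sub-∷ (Sub-rename ρ h) (Subᵇ-rename ρ k) (≡.subst (_ ↭_) (rrenameᵇ-++ ρ us vs) (rrenameᵇ-↭ q))

-- ρ inserts fresh variables below index d', moving it to index d.
record Shifts (ρ : ℕ → ℕ) (d' d : ℕ) : Set where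
  field
    below : ∀ {k} → k < d' → ρ k < d
    above : ∀ k → ρ (d' + k) ≡ d + k
open Shifts

ext-Shifts : ∀ {ρ d' d} → Shifts ρ d' d → Shifts (ext ρ) (suc d') (suc d)
ext-Shifts s .below {zero}  p       = s≤s z≤n
ext-Shifts s .below {suc k} (s≤s p) = s≤s (s .below p)
ext-Shifts s .above k               = cong suc (s .above k)

mutual
  -- Below `e` binders a substituted element `u` appears as `rrename (e +_) u`. A further
  -- substitution into it is carried back here to one into `u` itself, as the substitution lemma
  -- requires.
  Sub-unrename : ∀ {ρ d' d us w} u → Shifts ρ d' d → Sub d us (rrename ρ u) w →
                 ∃ λ u' → Sub d' us u u' × w ≡ rrename ρ u'
  Sub-unrename {ρ} {d'} {d} (rvar k) s h with <-cmp k d' | sub-var⁻ h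
  ... | tri< p _ _ | inj₁ (_ , e , _) = contradiction e (<⇒≢ (s .below p))
  ... | tri< p _ _ | inj₂ (inj₁ (_ , refl , refl)) = _ , sub-< p , refl
  ... | tri< p _ _ | inj₂ (inj₂ (j , e , q , _)) =
    contradiction (s .below p) (≤⇒≯ (≤-trans q (≤-trans (n≤1+n j) (≤-reflexive (≡.sym e)))))
  ... | tri≈ _ refl _ | inj₁ (v , e , refl , refl) =
    _ , sub-≡ , ≡.trans (rrename-cong (λ k → ≡.sym (s .above k)) v) (≡.sym (rrename-∘ ρ (d' +_) v))
  ... | tri≈ _ refl _ | inj₂ (inj₁ (p , _)) = contradiction p (≤⇒≯ (≤-reflexive (≡.sym ρd')))
    where ρd' : ρ d' ≡ d
          ρd' = ≡.trans (cong ρ (≡.sym (+-identityʳ d'))) (≡.trans (s .above 0) (+-identityʳ d))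
  ... | tri≈ _ refl _ | inj₂ (inj₂ (j , e , q , _)) = contradiction (≡.trans (≡.sym ρd') e) (<⇒≢ (s≤s q))
    where ρd' : ρ d' ≡ d
          ρd' = ≡.trans (cong ρ (≡.sym (+-identityʳ d'))) (≡.trans (s .above 0) (+-identityʳ d))
  Sub-unrename {ρ} {d'} {d} (rvar (suc k)) s h | tri> _ _ (s≤s p) | r with m≤n⇒∃[o]m+o≡n p
  ... | o , refl with ≡.trans (cong ρ (≡.sym (+-suc d' o))) (≡.trans (s .above (suc o)) (+-suc d o)) | r
  ... | ρk | inj₁ (_ , e , _) = contradiction (≡.trans (≡.sym ρk) e) (>⇒≢ (s≤s (m≤m+n d o)))
  ... | ρk | inj₂ (inj₁ (q , _)) =
    contradiction q (≤⇒≯ (≤-trans (m≤m+n d o) (≤-trans (n≤1+n _) (≤-reflexive (≡.sym ρk)))))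
  ... | ρk | inj₂ (inj₂ (j , e , q , refl , refl)) =
    _ , sub-> p , cong rvar (≡.trans (suc-injective (≡.trans (≡.sym e) ρk)) (≡.sym (s .above o)))
  Sub-unrename (rlam u) s (sub-lam h) with Sub-unrename u (ext-Shifts s) h
  ... | _ , h' , refl = _ , sub-lam h' , refl
  Sub-unrename (rapp u b) s (sub-app h k q) with Sub-unrename u s h | Subᵇ-unrename b s k
  ... | _ , h' , refl | _ , k' , refl = _ , sub-app h' k' q , refl

  Subᵇ-unrename : ∀ {ρ d' d us c} b → Shifts ρ d' d → Subᵇ d us (rrenameᵇ ρ b) c →
                  ∃ λ b' → Subᵇ d' us b b' × c ≡ rrenameᵇ ρ b'
  Subᵇ-unrename []      s sub-[] = _ , sub-[] , refl
  Subᵇ-unrename (u ∷ b) s (sub-∷ h k q) with Sub-unrename u s h | Subᵇ-unrename b s k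
  ... | _ , h' , refl | _ , k' , refl = _ , sub-∷ h' k' q , refl

-- `ρ` is `ρ'` followed by weakening at index `d`. The variable `d` is thus absent after renaming by
-- `ρ`, and substituting the empty bag for it only closes the gap.
Skips : ℕ → (ℕ → ℕ) → (ℕ → ℕ) → Set
Skips d ρ ρ' = ∀ k → (ρ k ≡ ρ' k × ρ' k < d) ⊎ (ρ k ≡ suc (ρ' k) × d ≤ ρ' k)

ext-Skips : ∀ {d ρ ρ'} → Skips d ρ ρ' → Skips (suc d) (ext ρ) (ext ρ')
ext-Skips s zero = inj₁ (refl , s≤s z≤n)
ext-Skips s (suc k) with s k
... | inj₁ (e , p) = inj₁ (cong suc e , s≤s p)
... | inj₂ (e , p) = inj₂ (cong suc e , s≤s p)

mutual
  Sub-skip : ∀ {d ρ ρ'} → Skips d ρ ρ' → ∀ v → Sub d [] (rrename ρ v) (rrename ρ' v)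
  Sub-skip s (rvar k) with s k
  ... | inj₁ (e , p) rewrite e = sub-< p
  ... | inj₂ (e , p) rewrite e = sub-> p
  Sub-skip s (rlam v)   = sub-lam (Sub-skip (ext-Skips s) v)
  Sub-skip s (rapp v b) = sub-app (Sub-skip s v) (Subᵇ-skip s b) refl

  Subᵇ-skip : ∀ {d ρ ρ'} → Skips d ρ ρ' → ∀ b → Subᵇ d [] (rrenameᵇ ρ b) (rrenameᵇ ρ' b)
  Subᵇ-skip s []      = sub-[]
  Subᵇ-skip s (t ∷ b) = sub-∷ (Sub-skip s t) (Subᵇ-skip s b) refl

+-Shifts : ∀ e d → Shifts (e +_) d (e + d)
+-Shifts e d .below p = +-monoʳ-< e p
+-Shifts e d .above k = ≡.sym (+-assoc e d k)

-- The substitution lemma p⟨q/x⟩⟨ws/y⟩ = Σ p⟨ws₁/y⟩⟨q⟨ws₂/y⟩/x⟩, the sum ranging over the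
-- splittings ws₁ + ws₂ of ws.
mutual
  Sub-Sub : ∀ {e d q p s ws w} → Sub e q p s → Sub (e + d) ws s w →
            ∃ λ ws₁ → ∃ λ ws₂ → ∃ λ p' → ∃ λ q' → ws ↭ ws₁ ++ ws₂ ×
            Sub (suc (e + d)) ws₁ p p' × Subᵇ d ws₂ q q' × Sub e q' p' w
  Sub-Sub {e} {d} (sub-≡ {u = u}) h with Sub-unrename u (+-Shifts e d) h
  ... | u' , h' , refl =
    [] , _ , rvar e , [ u' ] , refl , sub-< (s≤s (m≤m+n e d)) ,
    sub-∷ h' sub-[] (↭-reflexive (≡.sym (++-identityʳ _))) , sub-≡
  Sub-Sub {e} {d} (sub-< {k = k} p) h with sub-var⁻ h
  ... | inj₁ (_ , refl , _) = contradiction p (≤⇒≯ (m≤m+n e d))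
  ... | inj₂ (inj₁ (q , refl , refl)) =
    [] , [] , rvar k , [] , refl , sub-< (m<n⇒m<1+n q) , sub-[] , sub-< p
  ... | inj₂ (inj₂ (j , refl , q , _)) =
    contradiction p (≤⇒≯ (≤-trans (m≤m+n e d) (≤-trans q (n≤1+n j))))
  Sub-Sub {e} {d} (sub-> {k = k} p) h with sub-var⁻ h
  ... | inj₁ (u , refl , refl , refl) =
    [ u ] , [] , _ , [] , refl , sub-≡ , sub-[] ,
    Sub-skip (λ k → inj₂ (refl , ≤-trans (m≤m+n e d) (m≤m+n (e + d) k))) u
  ... | inj₂ (inj₁ (q , refl , refl)) =
    [] , [] , rvar (suc k) , [] , refl , sub-< (s≤s q) , sub-[] , sub-> p
  ... | inj₂ (inj₂ (j , refl , q , refl , refl)) =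
    [] , [] , rvar (suc j) , [] , refl , sub-> (s≤s q) , sub-[] , sub-> (≤-trans (m≤m+n e d) q)
  Sub-Sub (sub-lam g) (sub-lam h) with Sub-Sub g h
  ... | _ , _ , _ , _ , i , g' , k' , h' = _ , _ , _ , _ , i , sub-lam g' , k' , sub-lam h'
  Sub-Sub (sub-app g gᵇ i) (sub-app h hᵇ j) with Sub-Sub g h | Subᵇ-Sub gᵇ hᵇ
  ... | as₁ , as₂ , _ , _ , ia , ga , ka , ha | bs₁ , bs₂ , _ , _ , ib , gb , kb , hb
    with Subᵇ-↭ᵇ (↭-sym i) (Subᵇ-++ ka kb)
  ... | _ , k' , i' = _ , _ , _ , _ ,
    ↭-trans j (↭-trans (++⁺ ia ib) (interchange as₁ as₂ bs₁ bs₂)) ,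
    sub-app ga gb refl , k' , sub-app ha hb (↭-sym i')

  Subᵇ-Sub : ∀ {e d q b c ws c'} → Subᵇ e q b c → Subᵇ (e + d) ws c c' →
             ∃ λ ws₁ → ∃ λ ws₂ → ∃ λ b' → ∃ λ q' → ws ↭ ws₁ ++ ws₂ ×
             Subᵇ (suc (e + d)) ws₁ b b' × Subᵇ d ws₂ q q' × Subᵇ e q' b' c'
  Subᵇ-Sub sub-[] sub-[] = [] , [] , [] , [] , refl , sub-[] , sub-[] , sub-[]
  Subᵇ-Sub (sub-∷ g gᵇ i) (sub-∷ h hᵇ j) with Sub-Sub g h | Subᵇ-Sub gᵇ hᵇ
  ... | as₁ , as₂ , _ , _ , ia , ga , ka , ha | bs₁ , bs₂ , _ , _ , ib , gb , kb , hb
    with Subᵇ-↭ᵇ (↭-sym i) (Subᵇ-++ ka kb)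
  ... | _ , k' , i' = _ , _ , _ , _ ,
    ↭-trans j (↭-trans (++⁺ ia ib) (interchange as₁ as₂ bs₁ bs₂)) ,
    sub-∷ ga gb refl , k' , sub-∷ ha hb (↭-sym i')

infix 4 _↝_ _↝ᵇ_
data _↝_  : RTerm → RTerm → Set
data _↝ᵇ_ : Bag → Bag → Set

data _↝_ where
  ↝-β    : ∀ {t b t'} → Sub 0 b t t' → rapp (rlam t) b ↝ t'
  ↝-lam  : ∀ {t t'} → t ↝ t' → rlam t ↝ rlam t'
  ↝-appˡ : ∀ {t t' b} → t ↝ t' → rapp t b ↝ rapp t' b
  ↝-appʳ : ∀ {t b b'} → b ↝ᵇ b' → rapp t b ↝ rapp t b'

data _↝ᵇ_ where
  here  : ∀ {t t' b} → t ↝ t' → t ∷ b ↝ᵇ t' ∷ b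
  there : ∀ {t b b'} → b ↝ᵇ b' → t ∷ b ↝ᵇ t ∷ b'

mutual
  rrename-↝ : ∀ {t t'} ρ → t ↝ t' → rrename ρ t ↝ rrename ρ t'
  rrename-↝ ρ (↝-β h)    = ↝-β (Sub-rename ρ h)
  rrename-↝ ρ (↝-lam r)  = ↝-lam (rrename-↝ (ext ρ) r)
  rrename-↝ ρ (↝-appˡ r) = ↝-appˡ (rrename-↝ ρ r)
  rrename-↝ ρ (↝-appʳ r) = ↝-appʳ (rrename-↝ᵇ ρ r)

  rrename-↝ᵇ : ∀ {b b'} ρ → b ↝ᵇ b' → rrenameᵇ ρ b ↝ᵇ rrenameᵇ ρ b'
  rrename-↝ᵇ ρ (here r)  = here (rrename-↝ ρ r)
  rrename-↝ᵇ ρ (there r) = there (rrename-↝ᵇ ρ r)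

mutual
  -- This commutation and the one for a step in the bag allow a head redex to be fired before the
  -- steps inside it. When the inner step is itself a β step, `Sub-Sub` distributes `us` between its
  -- body and its bag.
  Sub-↝ : ∀ {d us t t' w} → t ↝ t' → Sub d us t' w → ∃ λ w' → Sub d us t w' × w' ↝ w
  Sub-↝ (↝-β g) h with Sub-Sub g h
  ... | _ , _ , _ , _ , i , g' , k , h' = _ , sub-app (sub-lam g') k i , ↝-β h'
  Sub-↝ (↝-lam r) (sub-lam h) with Sub-↝ r h
  ... | _ , h' , r' = _ , sub-lam h' , ↝-lam r'
  Sub-↝ (↝-appˡ r) (sub-app h k i) with Sub-↝ r h
  ... | _ , h' , r' = _ , sub-app h' k i , ↝-appˡ r'
  Sub-↝ (↝-appʳ r) (sub-app h k i) with Subᵇ-↝ r k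
  ... | _ , k' , r' = _ , sub-app h k' i , ↝-appʳ r'

  Subᵇ-↝ : ∀ {d us b b' c} → b ↝ᵇ b' → Subᵇ d us b' c → ∃ λ c' → Subᵇ d us b c' × c' ↝ᵇ c
  Subᵇ-↝ (here r) (sub-∷ h k i) with Sub-↝ r h
  ... | _ , h' , r' = _ , sub-∷ h' k i , here r'
  Subᵇ-↝ (there r) (sub-∷ h k i) with Subᵇ-↝ r k
  ... | _ , k' , r' = _ , sub-∷ h k' i , there r'

↝ᵇ-↭ : ∀ {us us' vs'} → us ↝ᵇ us' → us' ↭ vs' → ∃ λ vs → us ↭ vs × vs ↝ᵇ vs'
↝ᵇ-↭ r refl = _ , refl , r
↝ᵇ-↭ (here r) (prep _ p) = _ , prep _ p , here r
↝ᵇ-↭ (there r) (prep _ p) with ↝ᵇ-↭ r p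
... | _ , p' , r' = _ , prep _ p' , there r'
↝ᵇ-↭ (here r) (swap _ _ p) = _ , swap _ _ p , there (here r)
↝ᵇ-↭ (there (here r)) (swap _ _ p) = _ , swap _ _ p , here r
↝ᵇ-↭ (there (there r)) (swap _ _ p) with ↝ᵇ-↭ r p
... | _ , p' , r' = _ , swap _ _ p' , there (there r')
↝ᵇ-↭ r (trans p q) with ↝ᵇ-↭ r p
... | _ , p' , r' with ↝ᵇ-↭ r' q
... | _ , q' , r″ = _ , trans p' q' , r″

↝ᵇ-++ : ∀ us {vs ws} → ws ↝ᵇ us ++ vs →
        (∃ λ us' → ws ≡ us' ++ vs × us' ↝ᵇ us) ⊎ (∃ λ vs' → ws ≡ us ++ vs' × vs' ↝ᵇ vs)
↝ᵇ-++ []       r        = inj₂ (_ , refl , r)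
↝ᵇ-++ (u ∷ us) (here r) = inj₁ (_ , refl , here r)
↝ᵇ-++ (u ∷ us) (there r) with ↝ᵇ-++ us r
... | inj₁ (_ , refl , r') = inj₁ (_ , refl , there r')
... | inj₂ (_ , refl , r') = inj₂ (_ , refl , r')

-- Exactly one step is needed, since each element of the bag is used exactly once.
mutual
  Sub-↝ᵇ : ∀ {d us us' t w} → us ↝ᵇ us' → Sub d us' t w → ∃ λ w' → Sub d us t w' × w' ↝ w
  Sub-↝ᵇ {d} (here r) sub-≡ = _ , sub-≡ , rrename-↝ (d +_) r
  Sub-↝ᵇ r (sub-lam h) with Sub-↝ᵇ r h
  ... | _ , h' , r' = _ , sub-lam h' , ↝-lam r'
  Sub-↝ᵇ r (sub-app {us = us} h k i) with ↝ᵇ-↭ r i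
  ... | _ , i' , r' with ↝ᵇ-++ us r'
  ... | inj₁ (_ , refl , q) = let _ , h' , q' = Sub-↝ᵇ q h in _ , sub-app h' k i' , ↝-appˡ q'
  ... | inj₂ (_ , refl , q) = let _ , k' , q' = Subᵇ-↝ᵇ q k in _ , sub-app h k' i' , ↝-appʳ q'

  Subᵇ-↝ᵇ : ∀ {d us us' b c} → us ↝ᵇ us' → Subᵇ d us' b c → ∃ λ c' → Subᵇ d us b c' × c' ↝ᵇ c
  Subᵇ-↝ᵇ r (sub-∷ {us = us} h k i) with ↝ᵇ-↭ r i
  ... | _ , i' , r' with ↝ᵇ-++ us r'
  ... | inj₁ (_ , refl , q) = let _ , h' , q' = Sub-↝ᵇ q h in _ , sub-∷ h' k i' , here q'
  ... | inj₂ (_ , refl , q) = let _ , k' , q' = Subᵇ-↝ᵇ q k in _ , sub-∷ h k' i' , there q'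

-- Comparison with the reduction of formal sums

∈-insertions⇒↭ : ∀ {A : Set} {x : A} {zs} ys → zs ∈ insertions x ys → zs ↭ x ∷ ys
∈-insertions⇒↭ []       (here refl) = refl
∈-insertions⇒↭ (y ∷ ys) (here refl) = refl
∈-insertions⇒↭ (y ∷ ys) (there p) with ∈-map⁻ (y ∷_) p
... | _ , q , refl = trans (prep y (∈-insertions⇒↭ ys q)) (swap y _ refl)

∈-perms⇒↭ : ∀ {A : Set} {ys : List A} xs → ys ∈ perms xs → ys ↭ xs
∈-perms⇒↭ []       (here refl) = refl
∈-perms⇒↭ (x ∷ xs) p with find (∈-concatMap⁻ (insertions x) {xs = perms xs} p)
... | zs , q , r = trans (∈-insertions⇒↭ zs r) (prep x (∈-perms⇒↭ xs q))

∈-insertions : ∀ {A : Set} (x : A) ys zs → ys ++ x ∷ zs ∈ insertions x (ys ++ zs)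
∈-insertions x []       []       = here refl
∈-insertions x []       (z ∷ zs) = here refl
∈-insertions x (y ∷ ys) zs       = there (∈-map⁺ (y ∷_) (∈-insertions x ys zs))

↭⇒∈-perms : ∀ {A : Set} {ys : List A} xs → ys ↭ xs → ys ∈ perms xs
↭⇒∈-perms []       p with refl ← ↭-empty-inv p = here refl
↭⇒∈-perms (x ∷ xs) p with ∈-∃++ (∈-resp-↭ (↭-sym p) (here refl))
... | ys , zs , refl = ∈-concatMap⁺ (insertions x) {xs = perms xs}
  (lose (↭⇒∈-perms xs (drop-mid ys [] p)) (∈-insertions x ys zs))

true⇒≡ : ∀ {k d} → (k ≡ᵇ d) ≡ true → k ≡ d
true⇒≡ {k} {d} e = ≡ᵇ⇒≡ k d (≡.subst T (≡.sym e) tt)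

false⇒≢ : ∀ {k d} → (k ≡ᵇ d) ≡ false → ¬ k ≡ d
false⇒≢ {k} {d} e p = ≡.subst T e (≡⇒≡ᵇ k d p)

≡ᵇ-refl : ∀ d → (d ≡ᵇ d) ≡ true
≡ᵇ-refl zero    = refl
≡ᵇ-refl (suc d) = ≡ᵇ-refl d

<⇒≢ᵇ : ∀ {k d} → k < d → (k ≡ᵇ d) ≡ false
<⇒≢ᵇ {zero}  (s≤s p) = refl
<⇒≢ᵇ {suc k} (s≤s p) = <⇒≢ᵇ p

>⇒≢ᵇ : ∀ {k d} → d < k → (k ≡ᵇ d) ≡ false
>⇒≢ᵇ {d = zero}  (s≤s p) = refl
>⇒≢ᵇ {d = suc d} (s≤s p) = >⇒≢ᵇ p

<⇒<ᵇ-true : ∀ {k d} → k < d → (k <ᵇ d) ≡ true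
<⇒<ᵇ-true {zero}  (s≤s p) = refl
<⇒<ᵇ-true {suc k} (s≤s p) = <⇒<ᵇ-true p

≤⇒<ᵇ-false : ∀ {k d} → d ≤ k → (k <ᵇ d) ≡ false
≤⇒<ᵇ-false {d = zero}          p       = refl
≤⇒<ᵇ-false {suc k} {d = suc d} (s≤s p) = ≤⇒<ᵇ-false p

Sub-var : ∀ {k d} → ¬ k ≡ d → Sub d [] (rvar k) (if d <ᵇ k then rvar (pred k) else rvar k)
Sub-var {k} {d} k≢d with <-cmp k d
... | tri< p _ _ rewrite ≤⇒<ᵇ-false (<⇒≤ p) = sub-< p
... | tri≈ _ e _ = contradiction e k≢d
Sub-var {suc k} k≢d | tri> _ _ p@(s≤s q) rewrite <⇒<ᵇ-true p = sub-> q

mutual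
  -- `lin` reads its list from the left, and `vs` is the prefix consumed by `t`. The bound on `occ`
  -- excludes the fallback of `linVar` on an exhausted list, which would leave the variable in
  -- place.
  lin⇒Sub : ∀ d t us → occ d t ≤ length us →
            ∃ λ vs → length vs ≡ occ d t × us ≡ vs ++ proj₂ (lin d t us) × Sub d vs t (proj₁ (lin d t us))
  lin⇒Sub d (rvar k) [] p with k ≡ᵇ d in eq
  ... | false = [] , refl , refl , Sub-var (false⇒≢ eq)
  lin⇒Sub d (rvar k) (u ∷ us) p with k ≡ᵇ d in eq
  ... | false = [] , refl , refl , Sub-var (false⇒≢ eq)
  ... | true with refl ← true⇒≡ {k} {d} eq = [ u ] , refl , refl , sub-≡
  lin⇒Sub d (rlam t) us p with lin⇒Sub (suc d) t us p
  ... | vs , l , e , h = vs , l , e , sub-lam h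
  lin⇒Sub d (rapp t b) us p with lin⇒Sub d t us (m+n≤o⇒m≤o _ p)
  ... | vs , l , e , h with linᵇ⇒Subᵇ d b (proj₂ (lin d t us)) (rest-length {vs = vs} l e p)
  ... | vs' , l' , e' , k =
    vs ++ vs' , ≡.trans (length-++ vs) (cong₂ _+_ l l') ,
    ≡.trans e (≡.trans (cong (vs ++_) e') (≡.sym (++-assoc vs vs' _))) , sub-app h k refl

  linᵇ⇒Subᵇ : ∀ d b us → occᵇ d b ≤ length us →
              ∃ λ vs → length vs ≡ occᵇ d b × us ≡ vs ++ proj₂ (linᵇ d b us) × Subᵇ d vs b (proj₁ (linᵇ d b us))
  linᵇ⇒Subᵇ d []      us p = [] , refl , refl , sub-[]
  linᵇ⇒Subᵇ d (t ∷ b) us p with lin⇒Sub d t us (m+n≤o⇒m≤o _ p)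
  ... | vs , l , e , h with linᵇ⇒Subᵇ d b (proj₂ (lin d t us)) (rest-length {vs = vs} l e p)
  ... | vs' , l' , e' , k =
    vs ++ vs' , ≡.trans (length-++ vs) (cong₂ _+_ l l') ,
    ≡.trans e (≡.trans (cong (vs ++_) e') (≡.sym (++-assoc vs vs' _))) , sub-∷ h k refl

  rest-length : ∀ {m n} {us vs ws : List RTerm} → length vs ≡ m → us ≡ vs ++ ws →
                m + n ≤ length us → n ≤ length ws
  rest-length {m} {n} {us} {vs} {ws} l e p = +-cancelˡ-≤ m n (length ws) (begin
    m + n                  ≤⟨ p ⟩
    length us              ≡⟨ cong length e ⟩
    length (vs ++ ws)      ≡⟨ length-++ vs ⟩
    length vs + length ws  ≡⟨ cong (_+ length ws) l ⟩
    m + length ws          ∎)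
    where open ≤-Reasoning

mutual
  Sub⇒lin : ∀ {d ws t t'} → Sub d ws t t' →
            ∃ λ us → us ↭ ws × length us ≡ occ d t × (∀ vs → lin d t (us ++ vs) ≡ (t' , vs))
  Sub⇒lin {d} (sub-≡ {u = u}) rewrite ≡ᵇ-refl d = [ u ] , refl , refl , consume
    where
    consume : ∀ vs → linVar d d (u ∷ vs) ≡ (rrename (d +_) u , vs)
    consume vs rewrite ≡ᵇ-refl d = refl
  Sub⇒lin {d} (sub-< {k = k} p) rewrite <⇒≢ᵇ p = [] , refl , refl , keep
    where
    keep : ∀ vs → linVar d k vs ≡ (rvar k , vs)
    keep []       rewrite <⇒≢ᵇ p | ≤⇒<ᵇ-false (<⇒≤ p) = refl
    keep (v ∷ vs) rewrite <⇒≢ᵇ p | ≤⇒<ᵇ-false (<⇒≤ p) = refl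
  Sub⇒lin {d} (sub-> {k = k} p) rewrite >⇒≢ᵇ (s≤s p) = [] , refl , refl , keep
    where
    keep : ∀ vs → linVar d (suc k) vs ≡ (rvar k , vs)
    keep []       rewrite >⇒≢ᵇ (s≤s p) | <⇒<ᵇ-true (s≤s p) = refl
    keep (v ∷ vs) rewrite >⇒≢ᵇ (s≤s p) | <⇒<ᵇ-true (s≤s p) = refl
  Sub⇒lin (sub-lam h) with Sub⇒lin h
  ... | us , p , l , e = us , p , l , λ vs → cong (λ (s , vs) → rlam s , vs) (e vs)
  Sub⇒lin {d} (sub-app {s = s} {b = b} h k q) with Sub⇒lin h | Subᵇ⇒linᵇ k
  ... | us , p , l , e | us' , p' , l' , e' =
    us ++ us' , ↭-trans (++⁺ p p') (↭-sym q) , ≡.trans (length-++ us) (cong₂ _+_ l l') , eq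
    where
    eq : ∀ vs → lin d (rapp s b) ((us ++ us') ++ vs) ≡ _
    eq vs rewrite ++-assoc us us' vs | e (us' ++ vs) | e' vs = refl

  Subᵇ⇒linᵇ : ∀ {d ws b b'} → Subᵇ d ws b b' →
              ∃ λ us → us ↭ ws × length us ≡ occᵇ d b × (∀ vs → linᵇ d b (us ++ vs) ≡ (b' , vs))
  Subᵇ⇒linᵇ sub-[] = [] , refl , refl , λ _ → refl
  Subᵇ⇒linᵇ {d} (sub-∷ {t = t} {b = b} h k q) with Sub⇒lin h | Subᵇ⇒linᵇ k
  ... | us , p , l , e | us' , p' , l' , e' =
    us ++ us' , ↭-trans (++⁺ p p') (↭-sym q) , ≡.trans (length-++ us) (cong₂ _+_ l l') , eq
    where
    eq : ∀ vs → linᵇ d (t ∷ b) ((us ++ us') ++ vs) ≡ _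
    eq vs rewrite ++-assoc us us' vs | e (us' ++ vs) | e' vs = refl

∈-dsubst⇒Sub : ∀ {w} t b → w ∈ dsubst t b → Sub 0 b t w
∈-dsubst⇒Sub t b p with occ 0 t ≡ᵇ length b in eq
... | true with ∈-map⁻ (λ us → proj₁ (lin 0 t us)) p
...   | us , q , refl with ∈-perms⇒↭ b q
...   | us↭b with lin⇒Sub 0 t us (≤-reflexive occ≡)
  where occ≡ : occ 0 t ≡ length us
        occ≡ = ≡.trans (true⇒≡ eq) (≡.sym (↭-length us↭b))
...   | vs , l , e , h = Sub-↭ (↭-trans (↭-reflexive (≡.sym us≡vs)) us↭b) h
  where
  rest≡[] : ∀ {xs ys zs : List RTerm} → xs ≡ ys ++ zs → length ys ≡ length xs → xs ≡ ys
  rest≡[] {ys = []}     {[]}     refl _ = refl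
  rest≡[] {ys = y ∷ ys}          refl l = cong (y ∷_) (rest≡[] refl (suc-injective l))
  us≡vs = rest≡[] e (≡.trans l (≡.trans (true⇒≡ eq) (≡.sym (↭-length us↭b))))

Sub⇒∈-dsubst : ∀ {w} t b → Sub 0 b t w → w ∈ dsubst t b
Sub⇒∈-dsubst t b h with Sub⇒lin h
... | us , p , l , e rewrite ≡.trans (≡.sym l) (↭-length p) | ≡ᵇ-refl (length b) =
  ≡.subst (_∈ map (λ us → proj₁ (lin 0 t us)) (perms b))
    (cong proj₁ (≡.trans (cong (lin 0 t) (≡.sym (++-identityʳ us))) (e [])))
    (∈-map⁺ (λ us → proj₁ (lin 0 t us)) (↭⇒∈-perms b p))

↝ᵇ-mid : ∀ {t t' c} b → t ↝ t' → b ++ t ∷ c ↝ᵇ b ++ t' ∷ c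
↝ᵇ-mid []      r = here r
↝ᵇ-mid (u ∷ b) r = there (↝ᵇ-mid b r)

↦⇒↝ : ∀ {t a w} → t ↦ a → w ∈ a → t ↝ w
↦⇒↝ (r-β {t} {b}) p = ↝-β (∈-dsubst⇒Sub t b p)
↦⇒↝ (r-lam r) p with ∈-map⁻ rlam p
... | _ , q , refl = ↝-lam (↦⇒↝ r q)
↦⇒↝ (r-appˡ {b = b} r) p with ∈-map⁻ (λ t → rapp t b) p
... | _ , q , refl = ↝-appˡ (↦⇒↝ r q)
↦⇒↝ (r-appʳ {u} {b₁ = b₁} {b₂} r) p with ∈-map⁻ (λ t → rapp u (b₁ ++ t ∷ b₂)) p
... | _ , q , refl = ↝-appʳ (↝ᵇ-mid b₁ (↦⇒↝ r q))

mutual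
  ↝⇒↦ : ∀ {t w} → t ↝ w → ∃ λ a → t ↦ a × w ∈ a
  ↝⇒↦ (↝-β {t} {b} h) = _ , r-β , Sub⇒∈-dsubst t b h
  ↝⇒↦ (↝-lam r) with ↝⇒↦ r
  ... | _ , r' , p = _ , r-lam r' , ∈-map⁺ rlam p
  ↝⇒↦ (↝-appˡ {b = b} r) with ↝⇒↦ r
  ... | _ , r' , p = _ , r-appˡ r' , ∈-map⁺ (λ t → rapp t b) p
  ↝⇒↦ (↝-appʳ {t} r) with ↝ᵇ⇒↦ r
  ... | b₁ , b₂ , _ , _ , a , refl , refl , r' , p = _ , r-appʳ r' , ∈-map⁺ (λ u → rapp t (b₁ ++ u ∷ b₂)) p

  ↝ᵇ⇒↦ : ∀ {b c} → b ↝ᵇ c → ∃ λ b₁ → ∃ λ b₂ → ∃ λ t → ∃ λ w → ∃ λ a →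
         b ≡ b₁ ++ t ∷ b₂ × c ≡ b₁ ++ w ∷ b₂ × t ↦ a × w ∈ a
  ↝ᵇ⇒↦ (here r) with ↝⇒↦ r
  ... | a , r' , p = [] , _ , _ , _ , a , refl , refl , r' , p
  ↝ᵇ⇒↦ (there {t = u} r) with ↝ᵇ⇒↦ r
  ... | b₁ , b₂ , t , w , a , refl , refl , r' , p = u ∷ b₁ , b₂ , t , w , a , refl , refl , r' , p

infix 4 _↝*_
_↝*_ : RTerm → RTerm → Set
_↝*_ = Star _↝_

∈-replicate : ∀ {A : Set} {a b : A} k → b ∈ replicate k a → b ≡ a
∈-replicate (suc k) (here e)  = e
∈-replicate (suc k) (there p) = ∈-replicate k p

-- Coefficients are natural numbers, so nothing cancels and every term of a reduct descends from a
-- single term. Reduction of sums, and with it the cone, can therefore be studied one term at a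
-- time.
⟶⇒↝* : ∀ {S S' w} → S ⟶ S' → w ∈ S' → ∃ λ t → t ∈ S × t ↝* w
⟶⇒↝* (step {k = k} {t} {a} {b} p r q) w∈ with ∈-++⁻ (concat (replicate (suc k) a)) (∈-resp-↭ q w∈)
... | inj₂ w∈b = _ , ∈-resp-↭ (↭-sym p) (∈-++⁺ʳ (replicate (suc k) t) w∈b) , ε
... | inj₁ w∈as with ∈-concat⁻′ (replicate (suc k) a) w∈as
...   | a' , w∈a , a'∈ with refl ← ∈-replicate (suc k) a'∈ =
  t , ∈-resp-↭ (↭-sym p) (here refl) , ↦⇒↝ r w∈a ◅ ε

⟶*⇒↝* : ∀ {S S' w} → Star _⟶_ S S' → w ∈ S' → ∃ λ t → t ∈ S × t ↝* w
⟶*⇒↝* ε        p = _ , p , ε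
⟶*⇒↝* (r ◅ rs) p with ⟶*⇒↝* rs p
... | _ , p' , rs' with ⟶⇒↝* r p'
... | _ , p″ , r' = _ , p″ , r' ◅◅ rs'

≥r⇒↝* : ∀ {t s} → t ≥r s → ∃ λ w → t ↝* w × s ≋ w
≥r⇒↝* (a , rs , p) with find p
... | w , w∈a , s≋w with ⟶*⇒↝* rs w∈a
... | _ , here refl , rs' = w , rs' , s≋w

↝*⇒⟶* : ∀ {t w S} → t ↝* w → t ∈ S → ∃ λ S' → Star _⟶_ S S' × w ∈ S'
↝*⇒⟶* ε        p = _ , ε , p
↝*⇒⟶* {t} (r ◅ rs) p with ∈-∃++ p | ↝⇒↦ r
... | b , c , refl | a , r' , q with ↝*⇒⟶* rs (∈-++⁺ˡ {ys = b ++ c} (∈-++⁺ˡ {ys = []} q))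
-- A single copy of `t` is rewritten (multiplicity `suc 0`); the rest of the sum is carried along
-- unchanged.
... | S' , rs' , q' = S' , step {k = 0} (shift t b c) r' refl ◅ rs' , q'

mutual
  ≋-refl : ∀ {t} → t ≋ t
  ≋-refl {rvar k}   = ≋-var
  ≋-refl {rlam t}   = ≋-lam ≋-refl
  ≋-refl {rapp t b} = ≋-app ≋-refl ≋ᵇ-refl

  ≋ᵇ-refl : ∀ {b} → b ≋ᵇ b
  ≋ᵇ-refl {[]}    = []
  ≋ᵇ-refl {t ∷ b} = ≋-refl ∷ ≋ᵇ-refl

↝*⇒≥r : ∀ {t w} → t ↝* w → t ≥r w
↝*⇒≥r rs with ↝*⇒⟶* rs (here refl)
... | a , rs' , p = a , rs' , lose p ≋-refl

-- Taylor expansion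

mutual
  𝒯-rename : ∀ {ρ M s} → 𝒯 M s → 𝒯 (rename ρ M) (rrename ρ s)
  𝒯-rename t-var       = t-var
  𝒯-rename (t-lam p)   = t-lam (𝒯-rename p)
  𝒯-rename (t-app p q) = t-app (𝒯-rename p) (𝒯-renameᵇ q)
  𝒯-rename (t-⊕ˡ p)    = t-⊕ˡ (𝒯-rename p)
  𝒯-rename (t-⊕ʳ p)    = t-⊕ʳ (𝒯-rename p)

  𝒯-renameᵇ : ∀ {ρ M b} → All (𝒯 M) b → All (𝒯 (rename ρ M)) (rrenameᵇ ρ b)
  𝒯-renameᵇ []       = []
  𝒯-renameᵇ (p ∷ ps) = 𝒯-rename p ∷ 𝒯-renameᵇ ps

mutual
  𝒯-rename⁻ : ∀ {ρ} M {w} → 𝒯 (rename ρ M) w → ∃ λ s → 𝒯 M s × w ≡ rrename ρ s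
  𝒯-rename⁻ (var k)   t-var = rvar k , t-var , refl
  𝒯-rename⁻ (lam M)   (t-lam p) with 𝒯-rename⁻ M p
  ... | _ , p' , refl = _ , t-lam p' , refl
  𝒯-rename⁻ (app M N) (t-app p q) with 𝒯-rename⁻ M p | 𝒯-renameᵇ⁻ N q
  ... | _ , p' , refl | _ , q' , refl = _ , t-app p' q' , refl
  𝒯-rename⁻ (M ⊕ N)   (t-⊕ˡ p) with 𝒯-rename⁻ M p
  ... | _ , p' , e = _ , t-⊕ˡ p' , e
  𝒯-rename⁻ (M ⊕ N)   (t-⊕ʳ p) with 𝒯-rename⁻ N p
  ... | _ , p' , e = _ , t-⊕ʳ p' , e

  𝒯-renameᵇ⁻ : ∀ {ρ} M {c} → All (𝒯 (rename ρ M)) c → ∃ λ b → All (𝒯 M) b × c ≡ rrenameᵇ ρ b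
  𝒯-renameᵇ⁻ M []       = [] , [] , refl
  𝒯-renameᵇ⁻ M (p ∷ ps) with 𝒯-rename⁻ M p | 𝒯-renameᵇ⁻ M ps
  ... | _ , p' , refl | _ , ps' , refl = _ , p' ∷ ps' , refl

extsⁿ : ℕ → (ℕ → Term) → ℕ → Term
extsⁿ zero    σ = σ
extsⁿ (suc d) σ = exts (extsⁿ d σ)

rename-id : ∀ M → rename id M ≡ M
rename-id (var k)   = refl
rename-id (lam M)   = cong lam (≡.trans (rename-cong (λ { zero → refl ; (suc k) → refl }) M) (rename-id M))
rename-id (app M N) = cong₂ app (rename-id M) (rename-id N)
rename-id (M ⊕ N)   = cong₂ _⊕_ (rename-id M) (rename-id N)

extsⁿ-σ₀-< : ∀ {d k N} → k < d → extsⁿ d (σ₀ N) k ≡ var k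
extsⁿ-σ₀-< {suc d} {zero}  p       = refl
extsⁿ-σ₀-< {suc d} {suc k} (s≤s p) = cong (rename suc) (extsⁿ-σ₀-< {d} p)

extsⁿ-σ₀-≡ : ∀ d {N} → extsⁿ d (σ₀ N) d ≡ rename (d +_) N
extsⁿ-σ₀-≡ zero    {N} = ≡.sym (rename-id N)
extsⁿ-σ₀-≡ (suc d) {N} = ≡.trans (cong (rename suc) (extsⁿ-σ₀-≡ d)) (rename-∘ suc (d +_) N)

extsⁿ-σ₀-> : ∀ {d k N} → d ≤ k → extsⁿ d (σ₀ N) (suc k) ≡ var k
extsⁿ-σ₀-> {zero}          p       = refl
extsⁿ-σ₀-> {suc d} {suc k} (s≤s p) = cong (rename suc) (extsⁿ-σ₀-> {d} p)

mutual
  𝒯-subst : ∀ {d us s w M N} → Sub d us s w → 𝒯 M s → All (𝒯 N) us → 𝒯 (subst (extsⁿ d (σ₀ N)) M) w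
  𝒯-subst {d} {N = N} sub-≡ t-var (p ∷ []) rewrite extsⁿ-σ₀-≡ d {N} = 𝒯-rename p
  𝒯-subst {d} {N = N} (sub-< q) t-var [] rewrite extsⁿ-σ₀-< {d} {N = N} q = t-var
  𝒯-subst {d} {N = N} (sub-> q) t-var [] rewrite extsⁿ-σ₀-> {d} {N = N} q = t-var
  𝒯-subst (sub-lam h) (t-lam p) ps = t-lam (𝒯-subst h p ps)
  𝒯-subst (sub-app {us = us} h k q) (t-app p r) ps with All.++⁻ us (All-resp-↭ q ps)
  ... | ps₁ , ps₂ = t-app (𝒯-subst h p ps₁) (𝒯-substᵇ k r ps₂)
  𝒯-subst h (t-⊕ˡ p) ps = t-⊕ˡ (𝒯-subst h p ps)
  𝒯-subst h (t-⊕ʳ p) ps = t-⊕ʳ (𝒯-subst h p ps)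

  𝒯-substᵇ : ∀ {d us b c M N} → Subᵇ d us b c → All (𝒯 M) b → All (𝒯 N) us →
             All (𝒯 (subst (extsⁿ d (σ₀ N)) M)) c
  𝒯-substᵇ sub-[] [] ps = []
  𝒯-substᵇ (sub-∷ {us = us} h k q) (p ∷ r) ps with All.++⁻ us (All-resp-↭ q ps)
  ... | ps₁ , ps₂ = 𝒯-subst h p ps₁ ∷ 𝒯-substᵇ k r ps₂

mutual
  -- Expansions admit bags of every length, so the expansions of `N` met in `w` can be gathered into
  -- one bag, an element for each occurrence of the variable. This lifts a head step backwards to
  -- expansions.
  𝒯-subst⁻ : ∀ d M {N w} → 𝒯 (subst (extsⁿ d (σ₀ N)) M) w →
             ∃ λ s → ∃ λ us → 𝒯 M s × All (𝒯 N) us × Sub d us s w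
  𝒯-subst⁻ d (var k) {N} p with <-cmp k d
  ... | tri< q _ _ rewrite extsⁿ-σ₀-< {d} {k} {N} q with t-var ← p = rvar k , [] , t-var , [] , sub-< q
  ... | tri≈ _ refl _ rewrite extsⁿ-σ₀-≡ d {N} with 𝒯-rename⁻ N p
  ...   | u , p' , refl = rvar d , [ u ] , t-var , p' ∷ [] , sub-≡
  𝒯-subst⁻ d (var (suc k)) {N} p | tri> _ _ (s≤s q)
    rewrite extsⁿ-σ₀-> {d} {k} {N} q with t-var ← p = rvar (suc k) , [] , t-var , [] , sub-> q
  𝒯-subst⁻ d (lam M) (t-lam p) with 𝒯-subst⁻ (suc d) M p
  ... | _ , _ , p' , ps , h = _ , _ , t-lam p' , ps , sub-lam h
  𝒯-subst⁻ d (app M P) (t-app p q) with 𝒯-subst⁻ d M p | 𝒯-substᵇ⁻ d P q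
  ... | _ , _ , p' , ps , h | _ , _ , q' , qs , k =
    _ , _ , t-app p' q' , All.++⁺ ps qs , sub-app h k refl
  𝒯-subst⁻ d (M ⊕ P) (t-⊕ˡ p) with 𝒯-subst⁻ d M p
  ... | _ , _ , p' , ps , h = _ , _ , t-⊕ˡ p' , ps , h
  𝒯-subst⁻ d (M ⊕ P) (t-⊕ʳ p) with 𝒯-subst⁻ d P p
  ... | _ , _ , p' , ps , h = _ , _ , t-⊕ʳ p' , ps , h

  𝒯-substᵇ⁻ : ∀ d M {N c} → All (𝒯 (subst (extsⁿ d (σ₀ N)) M)) c →
              ∃ λ b → ∃ λ us → All (𝒯 M) b × All (𝒯 N) us × Subᵇ d us b c
  𝒯-substᵇ⁻ d M []       = [] , [] , [] , [] , sub-[]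
  𝒯-substᵇ⁻ d M (p ∷ ps) with 𝒯-subst⁻ d M p | 𝒯-substᵇ⁻ d M ps
  ... | _ , _ , p' , qs , h | _ , _ , ps' , qs' , k =
    _ , _ , p' ∷ ps' , All.++⁺ qs qs' , sub-∷ h k refl

-- Sizes of resource terms and of substitution instances

size  : RTerm → ℕ
sizeᵇ : Bag → ℕ
size (rvar k)   = 1
size (rlam s)   = suc (size s)
size (rapp s b) = suc (size s + sizeᵇ b)
sizeᵇ []      = 0
sizeᵇ (t ∷ b) = size t + sizeᵇ b

size>0 : ∀ t → 0 < size t
size>0 (rvar k)   = s≤s z≤n
size>0 (rlam t)   = s≤s z≤n
size>0 (rapp t b) = s≤s z≤n

mutual
  size-rrename : ∀ {ρ} t → size (rrename ρ t) ≡ size t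
  size-rrename (rvar k)   = refl
  size-rrename (rlam t)   = cong suc (size-rrename t)
  size-rrename (rapp t b) = cong suc (cong₂ _+_ (size-rrename t) (sizeᵇ-rrenameᵇ b))

  sizeᵇ-rrenameᵇ : ∀ {ρ} b → sizeᵇ (rrenameᵇ ρ b) ≡ sizeᵇ b
  sizeᵇ-rrenameᵇ []      = refl
  sizeᵇ-rrenameᵇ (t ∷ b) = cong₂ _+_ (size-rrename t) (sizeᵇ-rrenameᵇ b)

sizeᵇ-++ : ∀ b c → sizeᵇ (b ++ c) ≡ sizeᵇ b + sizeᵇ c
sizeᵇ-++ []      c = refl
sizeᵇ-++ (t ∷ b) c = ≡.trans (cong (size t +_) (sizeᵇ-++ b c)) (≡.sym (+-assoc (size t) (sizeᵇ b) (sizeᵇ c)))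

+-swap : ∀ m n o → m + (n + o) ≡ n + (m + o)
+-swap m n o = ≡.trans (≡.sym (+-assoc m n o)) (≡.trans (cong (_+ o) (+-comm m n)) (+-assoc n m o))

sizeᵇ-↭ : ∀ {b c} → b ↭ c → sizeᵇ b ≡ sizeᵇ c
sizeᵇ-↭ refl               = refl
sizeᵇ-↭ (prep t p)         = cong (size t +_) (sizeᵇ-↭ p)
sizeᵇ-↭ (swap {b} {c} t u p) =
  ≡.trans (+-swap (size t) (size u) (sizeᵇ b)) (cong (λ n → size u + (size t + n)) (sizeᵇ-↭ p))
sizeᵇ-↭ (trans p q)        = ≡.trans (sizeᵇ-↭ p) (sizeᵇ-↭ q)

sizeᵇ-split : ∀ {ws} us {vs} → ws ↭ us ++ vs → sizeᵇ ws ≡ sizeᵇ us + sizeᵇ vs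
sizeᵇ-split us {vs} p = ≡.trans (sizeᵇ-↭ p) (sizeᵇ-++ us vs)

mutual
  -- An occurrence, of size 1, gives way to a term of size at least 1. In `Sub-args-size≤`, all
  -- elements of `us` reappear in `w`. So body and bag of a redex are each at most as large as the
  -- contractum.
  Sub-size≥ : ∀ {d us t w} → Sub d us t w → size t ≤ size w
  Sub-size≥ (sub-≡ {d} {u}) = ≤-trans (size>0 u) (≤-reflexive (≡.sym (size-rrename u)))
  Sub-size≥ (sub-< p)       = ≤-refl
  Sub-size≥ (sub-> p)       = ≤-refl
  Sub-size≥ (sub-lam h)     = s≤s (Sub-size≥ h)
  Sub-size≥ (sub-app h k p) = s≤s (+-mono-≤ (Sub-size≥ h) (Subᵇ-size≥ k))

  Subᵇ-size≥ : ∀ {d us b c} → Subᵇ d us b c → sizeᵇ b ≤ sizeᵇ c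
  Subᵇ-size≥ sub-[]        = z≤n
  Subᵇ-size≥ (sub-∷ h k p) = +-mono-≤ (Sub-size≥ h) (Subᵇ-size≥ k)

mutual
  Sub-args-size≤ : ∀ {d us t w} → Sub d us t w → sizeᵇ us ≤ size w
  Sub-args-size≤ (sub-≡ {d} {u}) = ≤-reflexive (≡.trans (+-identityʳ (size u)) (≡.sym (size-rrename u)))
  Sub-args-size≤ (sub-< p)       = z≤n
  Sub-args-size≤ (sub-> p)       = z≤n
  Sub-args-size≤ (sub-lam h)     = m≤n⇒m≤1+n (Sub-args-size≤ h)
  Sub-args-size≤ (sub-app {us = us} h k p) rewrite sizeᵇ-split us p =
    m≤n⇒m≤1+n (+-mono-≤ (Sub-args-size≤ h) (Subᵇ-args-size≤ k))

  Subᵇ-args-size≤ : ∀ {d us b c} → Subᵇ d us b c → sizeᵇ us ≤ sizeᵇ c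
  Subᵇ-args-size≤ sub-[] = z≤n
  Subᵇ-args-size≤ (sub-∷ {us = us} h k p) rewrite sizeᵇ-split us p =
    +-mono-≤ (Sub-args-size≤ h) (Subᵇ-args-size≤ k)

+-interchange : ∀ m n o p → (m + n) + (o + p) ≡ (m + o) + (n + p)
+-interchange = ∙-interchange +-commutativeSemigroup

mutual
  Sub-size≤ : ∀ {d us t w} → Sub d us t w → size w ≤ size t + sizeᵇ us
  Sub-size≤ (sub-≡ {d} {u}) =
    ≤-trans (≤-reflexive (≡.trans (size-rrename u) (≡.sym (+-identityʳ (size u))))) (n≤1+n _)
  Sub-size≤ (sub-< p)   = ≤-refl
  Sub-size≤ (sub-> p)   = ≤-refl
  Sub-size≤ (sub-lam h) = s≤s (Sub-size≤ h)
  Sub-size≤ (sub-app {us = us} {vs} {s = s} {b = b} h k p) rewrite sizeᵇ-split us p =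
    s≤s (≤-trans (+-mono-≤ (Sub-size≤ h) (Subᵇ-size≤ k))
                 (≤-reflexive (+-interchange (size s) (sizeᵇ us) (sizeᵇ b) (sizeᵇ vs))))

  Subᵇ-size≤ : ∀ {d us b c} → Subᵇ d us b c → sizeᵇ c ≤ sizeᵇ b + sizeᵇ us
  Subᵇ-size≤ sub-[] = z≤n
  Subᵇ-size≤ (sub-∷ {us = us} {vs} {t = t} {b = b} h k p) rewrite sizeᵇ-split us p =
    ≤-trans (+-mono-≤ (Sub-size≤ h) (Subᵇ-size≤ k))
            (≤-reflexive (+-interchange (size t) (sizeᵇ us) (sizeᵇ b) (sizeᵇ vs)))

-- Spines of resource terms and their reductions

rapps : RTerm → List Bag → RTerm
rapps h []       = h
rapps h (b ∷ bs) = rapps (rapp h b) bs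

sizeˢ : List Bag → ℕ
sizeˢ []       = 0
sizeˢ (b ∷ bs) = suc (sizeᵇ b + sizeˢ bs)

size-rapps : ∀ h bs → size (rapps h bs) ≡ size h + sizeˢ bs
size-rapps h []       = ≡.sym (+-identityʳ (size h))
size-rapps h (b ∷ bs) = begin
  size (rapps (rapp h b) bs)                ≡⟨ size-rapps (rapp h b) bs ⟩
  suc (size h + sizeᵇ b + sizeˢ bs)         ≡⟨ cong suc (+-assoc (size h) (sizeᵇ b) (sizeˢ bs)) ⟩
  suc (size h + (sizeᵇ b + sizeˢ bs))       ≡⟨ +-suc (size h) _ ⟨
  size h + sizeˢ (b ∷ bs)                   ∎
  where open ≡.≡-Reasoning

𝒯ˢ : List Term → List Bag → Set
𝒯ˢ = Pointwise (λ N b → All (𝒯 N) b)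

𝒯-apps⁺ : ∀ {H h Ns bs} → 𝒯 H h → 𝒯ˢ Ns bs → 𝒯 (apps H Ns) (rapps h bs)
𝒯-apps⁺ p []       = p
𝒯-apps⁺ p (q ∷ qs) = 𝒯-apps⁺ (t-app p q) qs

𝒯-apps⁻ : ∀ {H} Ns {t} → 𝒯 (apps H Ns) t → ∃ λ h → ∃ λ bs → t ≡ rapps h bs × 𝒯 H h × 𝒯ˢ Ns bs
𝒯-apps⁻ []       p = _ , [] , refl , p , []
𝒯-apps⁻ (N ∷ Ns) p with 𝒯-apps⁻ Ns p
... | _ , _ , e , t-app p' q , qs = _ , _ , e , p' , q ∷ qs

infix 4 _↝ˢ_
data _↝ˢ_ : List Bag → List Bag → Set where
  here  : ∀ {b b' bs} → b ↝ᵇ b' → b ∷ bs ↝ˢ b' ∷ bs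
  there : ∀ {b bs bs'} → bs ↝ˢ bs' → b ∷ bs ↝ˢ b ∷ bs'

↝-rapps : ∀ {h h'} bs → h ↝ h' → rapps h bs ↝ rapps h' bs
↝-rapps []       r = r
↝-rapps (b ∷ bs) r = ↝-rapps bs (↝-appˡ r)

↝ˢ-rapps : ∀ h {bs bs'} → bs ↝ˢ bs' → rapps h bs ↝ rapps h bs'
↝ˢ-rapps h (here {bs = bs} r) = ↝-rapps bs (↝-appʳ r)
↝ˢ-rapps h (there r)          = ↝ˢ-rapps _ r

rapps-↝⁻ : ∀ {h} bs {w} → (∀ {s} → ¬ h ≡ rlam s) → rapps h bs ↝ w →
           (∃ λ h' → h ↝ h' × w ≡ rapps h' bs) ⊎ (∃ λ bs' → bs ↝ˢ bs' × w ≡ rapps h bs')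
rapps-↝⁻ []       ¬lam r = inj₁ (_ , r , refl)
rapps-↝⁻ (b ∷ bs) ¬lam r with rapps-↝⁻ bs (λ ()) r
... | inj₁ (_ , ↝-β _ , e)     with () ← ¬lam refl
... | inj₁ (_ , ↝-appˡ r' , e) = inj₁ (_ , r' , e)
... | inj₁ (_ , ↝-appʳ r' , e) = inj₂ (_ , here r' , e)
... | inj₂ (_ , r' , e)        = inj₂ (_ , there r' , e)

-- Membership in the cone over the terms whose bags have at most `n` elements.
Tame : ℕ → RTerm → Set
Tame n t = ∃ λ w → t ↝* w × BagsBounded n w

Tameᵇ : ℕ → Bag → Set
Tameᵇ n b = length b ≤ n × All (Tame n) b

Tame-↝ : ∀ {n t t'} → t ↝ t' → Tame n t' → Tame n t
Tame-↝ r (w , rs , p) = w , r ◅ rs , p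

-- This is why a bag that is never consumed already has its final length, and hence at most `n`
-- elements.
length-↝ᵇ : ∀ {b b'} → b ↝ᵇ b' → length b ≡ length b'
length-↝ᵇ (here r)  = refl
length-↝ᵇ (there r) = cong suc (length-↝ᵇ r)

All-Tame-↝ᵇ : ∀ {n b b'} → b ↝ᵇ b' → All (Tame n) b' → All (Tame n) b
All-Tame-↝ᵇ (here r)  (p ∷ ps) = Tame-↝ r p ∷ ps
All-Tame-↝ᵇ (there r) (p ∷ ps) = p ∷ All-Tame-↝ᵇ r ps

Tameᵇ-↝ᵇ : ∀ {n b b'} → b ↝ᵇ b' → Tameᵇ n b' → Tameᵇ n b
Tameᵇ-↝ᵇ r (l , ps) = ≡.subst (_≤ _) (≡.sym (length-↝ᵇ r)) l , All-Tame-↝ᵇ r ps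

Tameˢ-↝ˢ : ∀ {n bs bs'} → bs ↝ˢ bs' → All (Tameᵇ n) bs' → All (Tameᵇ n) bs
Tameˢ-↝ˢ (here r)  (p ∷ ps) = Tameᵇ-↝ᵇ r p ∷ ps
Tameˢ-↝ˢ (there r) (p ∷ ps) = p ∷ Tameˢ-↝ˢ r ps

-- Size bounds

BagsBounded-rapps : ∀ {n h} bs → BagsBounded n (rapps h bs) →
                    BagsBounded n h × All (λ b → length b ≤ n × All (BagsBounded n) b) bs
BagsBounded-rapps []       p = p , []
BagsBounded-rapps (b ∷ bs) p with BagsBounded-rapps bs p
... | bb-app q l qs , ps = q , (l , qs) ∷ ps

bounded⇒Tame : ∀ {n t} → BagsBounded n t → Tame n t
bounded⇒Tame p = _ , ε , p

bounded⇒Tameᵇ : ∀ {n b} → length b ≤ n × All (BagsBounded n) b → Tameᵇ n b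
bounded⇒Tameᵇ (l , ps) = l , All.map bounded⇒Tame ps

Tame-lam⁻ : ∀ {n t} → Tame n (rlam t) → Tame n t
Tame-lam⁻ (_ , ε , bb-lam p)       = bounded⇒Tame p
Tame-lam⁻ (w , ↝-lam r ◅ rs , p) = Tame-↝ r (Tame-lam⁻ (w , rs , p))

Tame-var⁻ : ∀ {n k w} bs → rapps (rvar k) bs ↝* w → BagsBounded n w → All (Tameᵇ n) bs
Tame-var⁻ bs ε p      = All.map bounded⇒Tameᵇ (proj₂ (BagsBounded-rapps bs p))
Tame-var⁻ bs (r ◅ rs) p with rapps-↝⁻ bs (λ ()) r
... | inj₂ (bs' , r' , refl) = Tameˢ-↝ˢ r' (Tame-var⁻ bs' rs p)

-- If the head redex survives the run, then body, bag and further arguments reduce independently. If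
-- it is fired, the firing is moved to the front past each earlier step: steps in the body or the
-- bag by `Sub-↝` and `Sub-↝ᵇ`, steps in `bs` because they are disjoint from it.
Tame-redex⁻ : ∀ {n s b v} bs → rapps (rapp (rlam s) b) bs ↝* v → BagsBounded n v →
              (Tame n s × Tameᵇ n b × All (Tameᵇ n) bs) ⊎ (∃ λ w → Sub 0 b s w × Tame n (rapps w bs))
Tame-redex⁻ bs ε p with BagsBounded-rapps bs p
... | bb-app (bb-lam q) l qs , ps =
  inj₁ (bounded⇒Tame q , bounded⇒Tameᵇ (l , qs) , All.map bounded⇒Tameᵇ ps)
Tame-redex⁻ bs (r ◅ rs) p with rapps-↝⁻ bs (λ ()) r
... | inj₁ (_ , ↝-β h , refl) = inj₂ (_ , h , _ , rs , p)
... | inj₁ (_ , ↝-appˡ (↝-lam r') , refl) with Tame-redex⁻ bs rs p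
...   | inj₁ (q , qᵇ , qs) = inj₁ (Tame-↝ r' q , qᵇ , qs)
...   | inj₂ (w , h , q)   = let w' , h' , r″ = Sub-↝ r' h in inj₂ (w' , h' , Tame-↝ (↝-rapps bs r″) q)
Tame-redex⁻ bs (r ◅ rs) p | inj₁ (_ , ↝-appʳ r' , refl) with Tame-redex⁻ bs rs p
...   | inj₁ (q , qᵇ , qs) = inj₁ (q , Tameᵇ-↝ᵇ r' qᵇ , qs)
...   | inj₂ (w , h , q)   = let w' , h' , r″ = Sub-↝ᵇ r' h in inj₂ (w' , h' , Tame-↝ (↝-rapps bs r″) q)
Tame-redex⁻ bs (r ◅ rs) p | inj₂ (bs' , r' , refl) with Tame-redex⁻ bs' rs p
...   | inj₁ (q , qᵇ , qs) = inj₁ (q , qᵇ , Tameˢ-↝ˢ r' qs)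
...   | inj₂ (w , h , q)   = inj₂ (w , h , Tame-↝ (↝ˢ-rapps w r') q)

SizeBounded : Term → Set
SizeBounded M = ∀ n → ∃ λ m → ∀ {t} → 𝒯 M t → Tame n t → size t ≤ m

sizeᵇ-bound : ∀ {N n m b} → (∀ {t} → 𝒯 N t → Tame n t → size t ≤ m) →
              All (𝒯 N) b → All (Tame n) b → sizeᵇ b ≤ length b * m
sizeᵇ-bound bound []       []       = z≤n
sizeᵇ-bound bound (p ∷ ps) (q ∷ qs) = +-mono-≤ (bound p q) (sizeᵇ-bound bound ps qs)

sizeˢ-bound : ∀ {Ns} → All SizeBounded Ns →
              ∀ n → ∃ λ m → ∀ {bs} → 𝒯ˢ Ns bs → All (Tameᵇ n) bs → sizeˢ bs ≤ m
sizeˢ-bound []       n = 0 , λ where [] [] → z≤n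
sizeˢ-bound (f ∷ fs) n with f n | sizeˢ-bound fs n
-- At most `n` elements of size at most `m` in the first bag; the successor is its application node.
... | m , bound | m' , bound' = suc (n * m + m') , λ where
  (p ∷ ps) ((l , q) ∷ qs) →
    s≤s (+-mono-≤ (≤-trans (sizeᵇ-bound bound p q) (*-monoˡ-≤ m l)) (bound' ps qs))

mutual
  SNI⇒SizeBounded : ∀ {M} → SNI M → SizeBounded M
  SNI⇒SizeBounded (sni-var {k} {Ns} as) n with sizeˢ-bound (All-SNI⇒SizeBounded as) n
  ... | m , bound = suc m , go
    where
    go : ∀ {t} → 𝒯 (apps (var k) Ns) t → Tame n t → size t ≤ suc m
    go p (_ , rs , q) with 𝒯-apps⁻ Ns p
    ... | _ , bs , refl , t-var , ps rewrite size-rapps (rvar k) bs = s≤s (bound ps (Tame-var⁻ bs rs q))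
  SNI⇒SizeBounded (sni-lam a) n with SNI⇒SizeBounded a n
  ... | m , bound = suc m , λ where (t-lam p) q → s≤s (bound p (Tame-lam⁻ q))
  SNI⇒SizeBounded (sni-⊕ {M} {N} {Ns} a a') n with SNI⇒SizeBounded a n | SNI⇒SizeBounded a' n
  ... | m , bound | m' , bound' = m + m' , go
    where
    go : ∀ {t} → 𝒯 (apps (M ⊕ N) Ns) t → Tame n t → size t ≤ m + m'
    go p q with 𝒯-apps⁻ Ns p
    ... | _ , _ , refl , t-⊕ˡ p' , ps = m≤n⇒m≤n+o m' (bound (𝒯-apps⁺ p' ps) q)
    ... | _ , _ , refl , t-⊕ʳ p' , ps = m≤n⇒m≤o+n m (bound' (𝒯-apps⁺ p' ps) q)
  SNI⇒SizeBounded (sni-β {M} {N} {Ns} a b cs d) n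
    with SNI⇒SizeBounded a n | sizeˢ-bound (SNI⇒SizeBounded b ∷ All-SNI⇒SizeBounded cs) n | SNI⇒SizeBounded d n
  -- One summand for each outcome of `Tame-redex⁻`. In the fired case `m₃` bounds the contractum,
  -- hence `s` on the one hand and all the bags on the other; the successors count an abstraction
  -- and an application.
  ... | m₁ , bound₁ | m₂ , bound₂ | m₃ , bound₃ = (suc m₁ + m₂) + (suc m₃ + suc m₃) , go
    where
    go : ∀ {t} → 𝒯 (apps (lam M) (N ∷ Ns)) t → Tame n t → size t ≤ (suc m₁ + m₂) + (suc m₃ + suc m₃)
    go p (_ , rs , q) with 𝒯-apps⁻ (N ∷ Ns) p
    ... | rlam s , b ∷ bs , refl , t-lam p' , ps ∷ pss rewrite size-rapps (rlam s) (b ∷ bs)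
      with Tame-redex⁻ bs rs q
    ...   | inj₁ (q' , qᵇ , qs) =
      m≤n⇒m≤n+o (suc m₃ + suc m₃) (+-mono-≤ (s≤s (bound₁ p' q')) (bound₂ (ps ∷ pss) (qᵇ ∷ qs)))
    ...   | inj₂ (w , h , q') =
      m≤n⇒m≤o+n (suc m₁ + m₂) (+-mono-≤ (s≤s (≤-trans (Sub-size≥ h) (m+n≤o⇒m≤o (size w) fired)))
                            (s≤s (≤-trans (+-monoˡ-≤ (sizeˢ bs) (Sub-args-size≤ h)) fired)))
      where
      fired : size w + sizeˢ bs ≤ m₃
      fired = ≡.subst (_≤ m₃) (size-rapps w bs) (bound₃ (𝒯-apps⁺ (𝒯-subst h p' ps) pss) q')

  All-SNI⇒SizeBounded : ∀ {Ns} → All SNI Ns → All SizeBounded Ns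
  All-SNI⇒SizeBounded []       = []
  All-SNI⇒SizeBounded (a ∷ as) = SNI⇒SizeBounded a ∷ All-SNI⇒SizeBounded as

-- Finitely many expansions of bounded size

listsUpTo : {A : Set} → ℕ → List A → List (List A)
listsUpTo zero    xs = [ [] ]
listsUpTo (suc m) xs = [] ∷ concatMap (λ x → map (x ∷_) (listsUpTo m xs)) xs

∈-listsUpTo : {A : Set} {xs ys : List A} → ∀ m → All (_∈ xs) ys → length ys ≤ m → ys ∈ listsUpTo m xs
∈-listsUpTo zero    []       l       = here refl
∈-listsUpTo (suc m) []       l       = here refl
∈-listsUpTo {xs = xs} (suc m) (p ∷ ps) (s≤s l) =
  there (∈-concatMap⁺ (λ x → map (x ∷_) (listsUpTo m xs)) {xs = xs}
          (lose p (∈-map⁺ (_ ∷_) (∈-listsUpTo m ps l))))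

-- Here `m` limits only the length of bags, which suffices for finiteness; terms of size above `m`
-- may be listed too.
expansions : ℕ → Term → List RTerm
expansions m (var k)   = [ rvar k ]
expansions m (lam M)   = map rlam (expansions m M)
expansions m (app M N) = concatMap (λ s → map (rapp s) (listsUpTo m (expansions m N))) (expansions m M)
expansions m (M ⊕ N)   = expansions m M ++ expansions m N

length≤sizeᵇ : ∀ b → length b ≤ sizeᵇ b
length≤sizeᵇ []      = z≤n
length≤sizeᵇ (t ∷ b) = +-mono-≤ (size>0 t) (length≤sizeᵇ b)

mutual
  ∈-expansions : ∀ {m M t} → 𝒯 M t → size t ≤ m → t ∈ expansions m M
  ∈-expansions t-var l = here refl
  ∈-expansions (t-lam p) l = ∈-map⁺ rlam (∈-expansions p (<⇒≤ l))
  ∈-expansions {m} {app M N} (t-app {s = s} {b} p q) l =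
    ∈-concatMap⁺ (λ s → map (rapp s) (listsUpTo m (expansions m N))) {xs = expansions m M}
      (lose (∈-expansions p (m+n≤o⇒m≤o (size s) (<⇒≤ l)))
            (∈-map⁺ (rapp s) (∈-listsUpTo m (All-∈-expansions q b≤) (≤-trans (length≤sizeᵇ b) b≤))))
    where b≤ = m+n≤o⇒n≤o (size s) (<⇒≤ l)
  ∈-expansions (t-⊕ˡ p) l = ∈-++⁺ˡ (∈-expansions p l)
  ∈-expansions {m} {M ⊕ N} (t-⊕ʳ p) l = ∈-++⁺ʳ (expansions m M) (∈-expansions p l)

  All-∈-expansions : ∀ {m M b} → All (𝒯 M) b → sizeᵇ b ≤ m → All (_∈ expansions m M) b
  All-∈-expansions []                 l = []
  All-∈-expansions {b = t ∷ b} (p ∷ ps) l =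
    ∈-expansions p (m+n≤o⇒m≤o (size t) l) ∷ All-∈-expansions ps (m+n≤o⇒n≤o (size t) l)

≋ᵇ-length : ∀ {b c} → b ≋ᵇ c → length b ≡ length c
≋ᵇ-length []          = refl
≋ᵇ-length (e ∷ es)    = cong suc (≋ᵇ-length es)
≋ᵇ-length swap        = refl
≋ᵇ-length (trans e f) = ≡.trans (≋ᵇ-length e) (≋ᵇ-length f)

mutual
  BagsBounded-≋ : ∀ {n s t} → s ≋ t → BagsBounded n s → BagsBounded n t
  BagsBounded-≋ ≋-var       p             = p
  BagsBounded-≋ (≋-lam e)   (bb-lam p)    = bb-lam (BagsBounded-≋ e p)
  BagsBounded-≋ (≋-app e f) (bb-app p l q) =
    bb-app (BagsBounded-≋ e p) (≡.subst (_≤ _) (≋ᵇ-length f) l) (All-BagsBounded-≋ f q)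

  All-BagsBounded-≋ : ∀ {n b c} → b ≋ᵇ c → All (BagsBounded n) b → All (BagsBounded n) c
  All-BagsBounded-≋ []          []           = []
  All-BagsBounded-≋ (e ∷ es)    (p ∷ ps)     = BagsBounded-≋ e p ∷ All-BagsBounded-≋ es ps
  All-BagsBounded-≋ swap        (p ∷ q ∷ ps) = q ∷ p ∷ ps
  All-BagsBounded-≋ (trans e f) ps           = All-BagsBounded-≋ f (All-BagsBounded-≋ e ps)

SN⇒finitary : ∀ M → SN M → ∀ 𝔗 → 𝔗 ⊆ˢ 𝔅 → ((↑ˢ 𝔗) ⊥) (𝒯 M)
SN⇒finitary M sn 𝔗 𝔗⊆𝔅 _ (a , a∈𝔗 , refl) with lower (𝔗⊆𝔅 a a∈𝔗)
... | n , bounded with SNI⇒SizeBounded (SN⇒SNI sn) n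
... | m , bound = expansions m M , covers
  where
  tame : ∀ {t} → ↑ a t → Tame n t
  tame (s , s∈a , t≥s) with ≥r⇒↝* t≥s
  ... | w , rs , s≋w = w , rs , BagsBounded-≋ s≋w (bounded s s∈a)

  covers : ∀ t → 𝒯 M t × ↑ a t → Any (t ≋_) (expansions m M)
  covers t (p , q) = lose (∈-expansions p (bound p (tame q))) ≋-refl

-- From finite traces on the linear cone to strong normalisation

mutual
  Linear-≋ : ∀ {s t} → s ≋ t → Linear s → Linear t
  Linear-≋ ≋-var       p           = p
  Linear-≋ (≋-lam e)   (l-lam p)   = l-lam (Linear-≋ e p)
  Linear-≋ (≋-app e f) (l-app p q) with Linear-≋ᵇ f q
  ... | _ , refl , q' = l-app (Linear-≋ e p) q'

  Linear-≋ᵇ : ∀ {u c} → [ u ] ≋ᵇ c → Linear u → ∃ λ v → c ≡ [ v ] × Linear v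
  Linear-≋ᵇ {c = v ∷ []}    (e ∷ _)  p = v , refl , Linear-≋ e p
  Linear-≋ᵇ {c = v ∷ w ∷ c} (e ∷ es) p with () ← ≋ᵇ-length es
  Linear-≋ᵇ (trans e f) p with Linear-≋ᵇ e p
  ... | _ , refl , p' = Linear-≋ᵇ f p'

mutual
  ≋-size : ∀ {s t} → s ≋ t → size s ≡ size t
  ≋-size ≋-var       = refl
  ≋-size (≋-lam e)   = cong suc (≋-size e)
  ≋-size (≋-app e f) = cong suc (cong₂ _+_ (≋-size e) (≋ᵇ-size f))

  ≋ᵇ-size : ∀ {b c} → b ≋ᵇ c → sizeᵇ b ≡ sizeᵇ c
  ≋ᵇ-size []                = refl
  ≋ᵇ-size (e ∷ es)          = cong₂ _+_ (≋-size e) (≋ᵇ-size es)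
  ≋ᵇ-size (swap {t} {u} {b}) = +-swap (size t) (size u) (sizeᵇ b)
  ≋ᵇ-size (trans e f)       = ≡.trans (≋ᵇ-size e) (≋ᵇ-size f)

Any-≋⇒size≤ : ∀ {t L} → Any (t ≋_) L → size t ≤ sizeᵇ L
Any-≋⇒size≤ {L = u ∷ L} (here e)  = m≤n⇒m≤n+o (sizeᵇ L) (≤-reflexive (≋-size e))
Any-≋⇒size≤ {L = u ∷ L} (there p) = m≤n⇒m≤o+n (size u) (Any-≋⇒size≤ p)

-- A default filling: singleton bags, and the left summand of each sum. It lies in the cone of
-- linear terms by the empty reduction, so it can pad any position without disturbing the target.
linear : Term → RTerm
linear (var k)   = rvar k
linear (lam M)   = rlam (linear M)
linear (app M N) = rapp (linear M) [ linear N ]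
linear (M ⊕ N)   = linear M

linear-𝒯 : ∀ M → 𝒯 M (linear M)
linear-𝒯 (var k)   = t-var
linear-𝒯 (lam M)   = t-lam (linear-𝒯 M)
linear-𝒯 (app M N) = t-app (linear-𝒯 M) (linear-𝒯 N ∷ [])
linear-𝒯 (M ⊕ N)   = t-⊕ˡ (linear-𝒯 M)

linear-Linear : ∀ M → Linear (linear M)
linear-Linear (var k)   = l-var
linear-Linear (lam M)   = l-lam (linear-Linear M)
linear-Linear (app M N) = l-app (linear-Linear M) (linear-Linear N)
linear-Linear (M ⊕ N)   = linear-Linear M

linearˢ : List Term → List Bag
linearˢ = map (λ N → [ linear N ])

linearˢ-𝒯ˢ : ∀ Ns → 𝒯ˢ Ns (linearˢ Ns)
linearˢ-𝒯ˢ []       = []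
linearˢ-𝒯ˢ (N ∷ Ns) = (linear-𝒯 N ∷ []) ∷ linearˢ-𝒯ˢ Ns

linearˢ-Linear : ∀ {h} Ns → Linear h → Linear (rapps h (linearˢ Ns))
linearˢ-Linear []       l = l
linearˢ-Linear (N ∷ Ns) l = linearˢ-Linear Ns (l-app l (linear-Linear N))

size-head≤ : ∀ h bs → size h ≤ size (rapps h bs)
size-head≤ h bs = ≤-trans (m≤m+n (size h) (sizeˢ bs)) (≤-reflexive (≡.sym (size-rapps h bs)))

Bounded : ℕ → Term → Set
Bounded m M = ∀ {t w} → 𝒯 M t → t ↝* w → Linear w → size t ≤ m

embed-arg : ∀ {h N t w} Ns → N ∈ Ns → Linear h → 𝒯 N t → t ↝* w → Linear w →
            ∃ λ bs → ∃ λ v → 𝒯ˢ Ns bs × rapps h bs ↝* v × Linear v × size t ≤ size (rapps h bs)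
embed-arg {h} {t = t} {w} (N ∷ Ns) (here refl) lh p rs l =
  [ t ] ∷ linearˢ Ns , rapps (rapp h [ w ]) (linearˢ Ns) , (p ∷ []) ∷ linearˢ-𝒯ˢ Ns ,
  gmap (λ t → rapps (rapp h [ t ]) (linearˢ Ns)) (λ r → ↝-rapps (linearˢ Ns) (↝-appʳ (here r))) rs ,
  linearˢ-Linear Ns (l-app lh l) ,
  ≤-trans (≤-trans (m≤m+n (size t) 0) (≤-trans (m≤n+m _ (size h)) (n≤1+n _)))
          (size-head≤ (rapp h [ t ]) (linearˢ Ns))
embed-arg (N ∷ Ns) (there i) lh p rs l
  with embed-arg Ns i (l-app lh (linear-Linear N)) p rs l
... | bs , v , q , rs' , l' , le = [ linear N ] ∷ bs , v , (linear-𝒯 N ∷ []) ∷ q , rs' , l' , le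

-- The run of a component is replayed inside the larger term, and a redex which the context forms
-- around it is left unfired; linear targets need not be normal. An expansion of a summand needs no
-- padding, being an expansion of the sum.
Bounded-▷ : ∀ {m M N} → Bounded m M → M ▷ N → Bounded m N
Bounded-▷ bound (▷-lam Ns) {t} p rs l =
  ≤-trans (≤-trans (n≤1+n _) (size-head≤ (rlam t) (linearˢ Ns)))
    (bound (𝒯-apps⁺ (t-lam p) (linearˢ-𝒯ˢ Ns))
           (gmap (λ t → rapps (rlam t) (linearˢ Ns)) (λ r → ↝-rapps (linearˢ Ns) (↝-lam r)) rs)
           (linearˢ-Linear Ns (l-lam l)))
Bounded-▷ bound (▷-arg H Ns i) p rs l with embed-arg Ns i (linear-Linear H) p rs l
... | bs , v , q , rs' , l' , le = ≤-trans le (bound (𝒯-apps⁺ (linear-𝒯 H) q) rs' l')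
Bounded-▷ bound (▷-⊕ˡ Ns) p rs l with 𝒯-apps⁻ Ns p
... | _ , _ , refl , p' , ps = bound (𝒯-apps⁺ (t-⊕ˡ p') ps) rs l
Bounded-▷ bound (▷-⊕ʳ Ns) p rs l with 𝒯-apps⁻ Ns p
... | _ , _ , refl , p' , ps = bound (𝒯-apps⁺ (t-⊕ʳ p') ps) rs l

Bounded-head : ∀ {m M N} → Bounded m M → M →h N → ∃ λ j → j < m × Bounded j N
-- The bound 0 is impossible: `linear M` has positive size and is its own linear target.
Bounded-head {zero} {M} bound r =
  contradiction (bound (linear-𝒯 M) ε (linear-Linear M)) (<⇒≱ (size>0 (linear M)))
Bounded-head {suc m} bound (h-β {M} {N} Ns) = m , ≤-refl , bound'
  where
  bound' : Bounded m (apps (M [ N /0]) Ns)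
  bound' p rs l with 𝒯-apps⁻ Ns p
  ... | w , bs , refl , p' , ps with 𝒯-subst⁻ 0 M p'
  ... | s , us , q , qs , h = ≤-pred (begin
    suc (size (rapps w bs))              ≡⟨ cong suc (size-rapps w bs) ⟩
    -- The redex contains an abstraction and an application node besides `s` and `us`; one of the
    -- two already makes the inequality strict.
    suc (size w + sizeˢ bs)              ≤⟨ s≤s (+-monoˡ-≤ (sizeˢ bs) (≤-trans (Sub-size≤ h) (n≤1+n _))) ⟩
    size (rapp (rlam s) us) + sizeˢ bs   ≡⟨ size-rapps (rapp (rlam s) us) bs ⟨
    size (rapps (rapp (rlam s) us) bs)   ≤⟨ bound (𝒯-apps⁺ (t-app (t-lam q) qs) ps) (↝-rapps bs (↝-β h) ◅ rs) l ⟩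
    suc m                                ∎)
    where open ≤-Reasoning

finitary⇒SN : ∀ M 𝔗 → 𝔏 ⊆ˢ 𝔗 → ((↑ˢ 𝔗) ⊥) (𝒯 M) → SN M
finitary⇒SN M 𝔗 𝔏⊆𝔗 fin
  with fin (↑ Linear) (Linear , 𝔏⊆𝔗 Linear (lift (Linear-≋ , λ _ l → l)) , refl)
-- A single test set is enough, that of all linear terms. The initial bound `sizeᵇ L` is the total
-- size of the finite cover, which dominates the size of each member.
... | L , covers = SNI⇒SN (Perpetual.sni _<_ Bounded Bounded-▷ Bounded-head (<-wellFounded (sizeᵇ L))
  λ {t} p rs l → Any-≋⇒size≤ (covers t (p , _ , l , ↝*⇒≥r rs)))

theorem2 : (∀ (M : Term) → SN M → ∀ (𝔗 : Structure) → 𝔗 ⊆ˢ 𝔅 → ((↑ˢ 𝔗) ⊥) (𝒯 M))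
    × (∀ (M : Term) (𝔗 : Structure) → 𝔏 ⊆ˢ 𝔗 → ((↑ˢ 𝔗) ⊥) (𝒯 M) → SN M)
theorem2 = SN⇒finitary , finitary⇒SN
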